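{- Let $\mathcal{A}=\lambda/\mu$ be a skew diagram which decomposes into two disconnected pieces which are (translates of) the Young diagrams of nonempty partitions $\alpha$ and $\beta$. Then \[hl(\mathcal{A})=hl(\alpha)+hl(\beta)=\pi_{nw}(\mathcal{A}).\] Furthermore, there are exactly $2^{\min(d(\alpha),d(\beta))}$ partitions $\nu$ with $hl(\nu)=hl(\mathcal{A})$ and $[\nu]$ appearing in $[\mathcal{A}]$, and each of these $[\nu]$ appears in $[\mathcal{A}]$ with multiplicity $1$.
   Context: Partitions are identified with their Young diagrams in matrix coordinates (box $(i,j)$ is in row $i$, column $j$); $l(\lambda)$ is the number of nonzero parts; sums of partitions (or of finite sequences) are taken componentwise, padding with zeros. For $\mu\subseteq\lambda$ the skew diagram $\lambda/\mu$ is the set of boxes of $\lambda$ not in $\mu$; skew diagrams are regarded up to translation. $c(\lambda;\mu,\nu)$ denotes the Littlewood–Richardson coefficient, and the skew character of $S_n$ is $[\lambda/\mu]=\sum_\nu c(\lambda;\mu,\nu)[\nu]$, where $[\nu]$ is the irreducible character labelled by $\nu$; $[\nu]$ appears in $[\mathcal{A}]$ iff its coefficient (its multiplicity) is nonzero. When $\lambda/\mu$ decomposes into disconnected pieces of shapes $\alpha,\beta$ one has $[\lambda/\mu]=\sum_\nu c(\nu;\alpha,\beta)[\nu]$. A skew diagram decomposes into disconnected diagrams $\mathcal{B},\mathcal{C}$ if no box of $\mathcal{B}$ lies in the same row or column as a box of $\mathcal{C}$. Northwest ribbons: for a skew diagram $\mathcal{A}$, $nw_1(\mathcal{A})$ is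 the set of boxes $(i,j)\in\mathcal{A}$ with $(i-1,j-1)\notin\mathcal{A}$ (for connected $\mathcal{A}$ this is the ribbon running along the northwest border from the lowest box of the leftmost column to the rightmost box of the top row; for disconnected $\mathcal{A}$ it is the union of the $nw_1$ of the components), and $nw_{k+1}(\mathcal{A})=nw_1$ of the diagram obtained from $\mathcal{A}$ by removing $nw_1(\mathcal{A}),\dots,nw_k(\mathcal{A})$. The northwest ribbon length partition is $\pi_{nw}(\mathcal{A})=(|nw_1(\mathcal{A})|,|nw_2(\mathcal{A})|,\dots)$. For a partition $\lambda$, $hl_i(\lambda)$ is the hook length of the box $(i,i)$ (zero if $(i,i)\notin\lambda$) and $hl(\lambda)=(hl_1(\lambda),hl_2(\lambda),\dots)$. For a skew diagram $\mathcal{A}$, $hl(\mathcal{A})$ is the lexicographically largest $hl(\nu)$ among all $\nu$ with $[\nu]$ appearing in $[\mathcal{A}]$. The Durfee size $d(\lambda)$ is the largest $d$ with $(d^d)\subseteq\lambda$. -}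

module Defs where

open import Data.Nat using (ℕ; zero; suc; _+_; _*_; _∸_; _≤_; _<_; _≤ᵇ_; _<ᵇ_; _≡ᵇ_; _⊔_)
open import Data.Bool using (Bool; true; false; _∧_; _∨_; not; if_then_else_; T)
open import Data.List using (List; []; _∷_; length; map; filterᵇ; concat; concatMap; upTo; reverse; foldr; inits)
open import Data.Bool.ListAction using (and; or)
open import Data.Product using (_×_; _,_; Σ; ∃)
open import Data.Sum using (_⊎_)
open import Data.Empty using (⊥)
open import Data.Unit using (⊤)
open import Relation.Binary.PropositionalEquality using (_≡_)
open import Relation.Nullary using (¬_)
open import Function.Bundles using (_⇔_)

data IsPartition : List ℕ → Set where
  nil  : IsPartition []
  one  : ∀ {x} → 1 ≤ x → IsPartition (x ∷ [])
  cons : ∀ {x y ys} → y ≤ x → IsPartition (y ∷ ys) → IsPartition (x ∷ y ∷ ys)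

-- 1-indexed part λ_i, zero outside (and for the invalid index 0)
part : List ℕ → ℕ → ℕ
part [] _ = 0
part (x ∷ xs) zero = 0
part (x ∷ xs) (suc zero) = x
part (x ∷ xs) (suc (suc i)) = part xs (suc i)

oneTo : ℕ → List ℕ
oneTo n = map suc (upTo n)

_⊆P_ : List ℕ → List ℕ → Set
mu ⊆P la = ∀ i → part mu i ≤ part la i

-- Boxes in matrix coordinates (row, column), 1-indexed.

Box : Set
Box = ℕ × ℕ

InYD : List ℕ → Box → Set
InYD la (i , j) = (1 ≤ i) × (1 ≤ j) × (j ≤ part la i)

InSkew : List ℕ → List ℕ → Box → Set
InSkew la mu b = InYD la b × ¬ InYD mu b

InTranslate : List ℕ → ℕ → ℕ → Box → Set
InTranslate al a b (i , j) =
  Σ ℕ λ i' → Σ ℕ λ j' → InYD al (i' , j') × (i ≡ i' + a) × (j ≡ j' + b)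

DecomposesInto : List ℕ → List ℕ → List ℕ → List ℕ → Set
DecomposesInto la mu al be =
  Σ ℕ λ a → Σ ℕ λ b → Σ ℕ λ c → Σ ℕ λ d →
    (∀ x → InSkew la mu x ⇔ (InTranslate al a b x ⊎ InTranslate be c d x))
    × (∀ i j i' j' → InTranslate al a b (i , j) → InTranslate be c d (i' , j')
         → ¬ (i ≡ i') × ¬ (j ≡ j'))

skewBoxes : List ℕ → List ℕ → List Box
skewBoxes la mu =
  concatMap (λ i → map (λ t → (i , part mu i + suc t)) (upTo (part la i ∸ part mu i)))
            (oneTo (length la))

_==B_ : Box → Box → Bool
(i , j) ==B (k , l) = (i ≡ᵇ k) ∧ (j ≡ᵇ l)

memB : Box → List Box → Bool
memB x A = or (map (x ==B_) A)

-- nw_1(A): boxes (i,j) ∈ A with (i-1,j-1) ∉ A (rows/columns start at 1,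
-- so index 0 never occurs in A)
nw1 : List Box → List Box
nw1 A = filterᵇ (λ { (i , j) → not (memB (i ∸ 1 , j ∸ 1) A) }) A

removeB : List Box → List Box → List Box
removeB R A = filterᵇ (λ x → not (memB x R)) A

-- lengths of nw_1, nw_2, ... (fuel = number of boxes suffices)
nwLengths : ℕ → List Box → List ℕ
nwLengths zero _ = []
nwLengths (suc f) [] = []
nwLengths (suc f) (x ∷ A) = length (nw1 (x ∷ A)) ∷ nwLengths f (removeB (nw1 (x ∷ A)) (x ∷ A))

-- π_nw(λ/μ), listing its nonzero entries
πnw : List ℕ → List ℕ → List ℕ
πnw la mu = nwLengths (length (skewBoxes la mu)) (skewBoxes la mu)

squareIn : List ℕ → ℕ → Bool
squareIn la d = and (map (λ i → d ≤ᵇ part la i) (oneTo d))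

-- largest d with (d^d) ⊆ λ  (such d is at most l(λ))
durfee : List ℕ → ℕ
durfee la = foldr (λ d acc → if squareIn la d then d ⊔ acc else acc) 0 (upTo (suc (length la)))

conj : List ℕ → ℕ → ℕ
conj la j = length (filterᵇ (λ x → j ≤ᵇ x) la)

-- hook length of the box (i,i), zero if (i,i) ∉ λ
hlAt : List ℕ → ℕ → ℕ
hlAt la i = if (i ≤ᵇ part la i) ∧ (1 ≤ᵇ i)
            then (part la i ∸ i) + (conj la i ∸ i) + 1 else 0

-- hl(λ) = (hl_1(λ), hl_2(λ), ...), listing its nonzero entries
-- (hl_i(λ) > 0 exactly for i ≤ d(λ))
hl : List ℕ → List ℕ
hl la = map (hlAt la) (oneTo (durfee la))

_⊕_ : List ℕ → List ℕ → List ℕ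
[] ⊕ ys = ys
(x ∷ xs) ⊕ [] = x ∷ xs
(x ∷ xs) ⊕ (y ∷ ys) = (x + y) ∷ (xs ⊕ ys)

-- lexicographic order on finite sequences padded with zeros
_≤lex_ : List ℕ → List ℕ → Set
[] ≤lex ys = ⊤
(x ∷ xs) ≤lex [] = (x ≡ 0) × (xs ≤lex [])
(x ∷ xs) ≤lex (y ∷ ys) = (x < y) ⊎ ((x ≡ y) × (xs ≤lex ys))

-- Littlewood–Richardson coefficients c(λ; μ, ν): the number of
-- Littlewood–Richardson tableaux of shape λ/μ and content ν, i.e.
-- semistandard fillings of λ/μ with content ν whose reverse reading word
-- (rows read right to left, top to bottom) is a lattice word.

words : ℕ → ℕ → List (List ℕ)
words m zero = [] ∷ []
words m (suc n) = concatMap (λ k → map (k ∷_) (words m n)) (oneTo m)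

choices : List (List (List ℕ)) → List (List (List ℕ))
choices [] = [] ∷ []
choices (xs ∷ xss) = concatMap (λ x → map (x ∷_) (choices xss)) xs

fillings : List ℕ → List ℕ → ℕ → List (List (List ℕ))
fillings la mu m = choices (map (λ i → words m (part la i ∸ part mu i)) (oneTo (length la)))

at : List ℕ → ℕ → ℕ
at [] _ = 0
at (x ∷ xs) zero = x
at (x ∷ xs) (suc k) = at xs k

rowOf : List (List ℕ) → ℕ → List ℕ
rowOf [] _ = []
rowOf (r ∷ rs) zero = []
rowOf (r ∷ rs) (suc zero) = r
rowOf (r ∷ rs) (suc (suc i)) = rowOf rs (suc i)

entry : List ℕ → List (List ℕ) → Box → ℕ
entry mu t (i , j) = at (rowOf t i) (j ∸ suc (part mu i))

weaklyIncr : List ℕ → Bool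
weaklyIncr [] = true
weaklyIncr (x ∷ []) = true
weaklyIncr (x ∷ y ∷ ys) = (x ≤ᵇ y) ∧ weaklyIncr (y ∷ ys)

count : ℕ → List ℕ → ℕ
count k w = length (filterᵇ (λ x → x ≡ᵇ k) w)

isSSYT : List ℕ → List ℕ → List (List ℕ) → Bool
isSSYT la mu t =
  and (map weaklyIncr t) ∧
  and (map (λ { (i , j) → if memB (suc i , j) (skewBoxes la mu)
                           then entry mu t (i , j) <ᵇ entry mu t (suc i , j)
                           else true })
           (skewBoxes la mu))

hasContent : List ℕ → List (List ℕ) → Bool
hasContent nu t = and (map (λ k → count k (concat t) ≡ᵇ part nu k) (oneTo (length nu)))

isLattice : ℕ → List ℕ → Bool
isLattice m w = and (map (λ p → and (map (λ k → count (suc k) p ≤ᵇ count k p) (oneTo m))) (inits w))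

isLR : List ℕ → List ℕ → List ℕ → List (List ℕ) → Bool
isLR la mu nu t = isSSYT la mu t ∧ hasContent nu t ∧ isLattice (length nu) (concatMap reverse t)

-- c(λ; μ, ν) = multiplicity of [ν] in the skew character [λ/μ]
lrCoeff : List ℕ → List ℕ → List ℕ → ℕ
lrCoeff la mu nu = length (filterᵇ (isLR la mu nu) (fillings la mu (length nu)))

Appears : List ℕ → List ℕ → List ℕ → Set
Appears la mu nu = IsPartition nu × ¬ (lrCoeff la mu nu ≡ 0)

IsHlOf : List ℕ → List ℕ → List ℕ → Set
IsHlOf la mu h =
  (Σ (List ℕ) λ nu → Appears la mu nu × hl nu ≡ h)
  × (∀ nu → Appears la mu nu → hl nu ≤lex h)

{-# OPTIONS --safe #-}

-- Let α be the upper of the two pieces.  In a Littlewood–Richardson filling of α ⊔ β the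
-- piece α is filled with i's in row i, so a filling of content ν is a semistandard tableau
-- T of shape β whose reading word stays a lattice word when it follows a word of content α.
-- The 1's of T lie in its first row, and row i of T has entries at most l(α) + i.  If ν has
-- l(α) + l(β) rows then the first row of T ends with l(α) + 1, so that it contains at most
-- β₁ - 1 letters 1.  Hence ν₁ + l(ν) - 1 ≤ hl₁(α) + hl₁(β), and equality holds in exactly two
-- cases: the first row of T is 1 ⋯ 1 and row i > 1 ends with l(α) + i - 1, or it is
-- 1 ⋯ 1, l(α) + 1 and row i ends with l(α) + i.  In both cases, deleting the first row and
-- the last box of every row, and lowering the entries by one, gives a tableau of the same
-- kind for the partitions obtained from α, β, ν by removing their first hooks, and this is
-- reversible.  So there are two choices for every hook until α or β is exhausted, after
-- which the filling is forced.  Likewise, removing nw₁ from the skew diagram removes the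
-- first hooks of α and β.
module Submission where

open import Defs
open import Algebra.Properties.CommutativeSemigroup using (interchange)
open import Data.Bool using (Bool; true; false; T; if_then_else_; not; _∨_)
open import Data.Bool.ListAction using (and)
open import Data.Bool.Properties using (T-∧; T-∨; T-≡; T-not-≡)
open import Data.List using (List; []; _∷_; [_]; _++_; length; map; filterᵇ; upTo; applyUpTo; foldr; concat; concatMap; reverse; replicate; inits; cartesianProductWith)
open import Data.List.Membership.Propositional using (_∈_)
open import Data.List.Membership.Propositional.Properties using (∈-upTo⁺; ∈-upTo⁻; ∈-map⁺; ∈-map⁻; ∈-++⁺ˡ; ∈-++⁺ʳ; ∈-++⁻; ∈-filter⁺; ∈-filter⁻; ∈-concat⁺′; ∈-concat⁻′; ∈-cartesianProductWith⁺; ∈-cartesianProductWith⁻)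
open import Data.List.Properties using (map-cong; map-∘; map-applyUpTo; map-upTo; map-id-local; filter-++; filter-all; filter-none; filter-accept; filter-reject; length-++; length-map; length-filter; length-replicate; length-upTo; unfold-reverse; reverse-++; concat-++; ++-assoc; ++-identityʳ; ∷-injective; ∷-injectiveˡ; ∷-injectiveʳ)
open import Data.List.Relation.Binary.Pointwise as Pointwise using (Pointwise; []; _∷_; Pointwise-length)
open import Data.List.Relation.Unary.All as All using (All; []; _∷_)
import Data.List.Relation.Unary.All.Properties as All
open import Data.List.Relation.Unary.AllPairs as AllPairs using (AllPairs; []; _∷_)
import Data.List.Relation.Unary.AllPairs.Properties as AllPairs
open import Data.List.Relation.Unary.Any as Any using (here; there)
import Data.List.Relation.Unary.Any.Properties as Any
open import Data.List.Relation.Unary.Unique.Propositional using (Unique)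
import Data.List.Relation.Unary.Unique.Propositional.Properties as Unique
open import Data.Nat
open import Data.Nat.Properties
open import Data.Product using (_×_; _,_; proj₁; proj₂; ∃; Σ)
open import Data.Sum as Sum using (_⊎_; inj₁; inj₂)
open import Function using (_∘_; id)
open import Function.Bundles using (Equivalence; _⇔_; mk⇔)
open import Relation.Binary.Definitions using (tri<; tri≈; tri>)
open import Relation.Binary.PropositionalEquality hiding ([_])
open import Relation.Nullary using (¬_; yes; no; contradiction)
open import Relation.Nullary.Decidable using (T?)

open Equivalence using (to; from)

-- Hook removal stays among tableaux of the same kind for the following reason. The first column of
-- ν has one box for each letter. For the letters up to l(α) this box lies in the first column of α;
-- each further letter enters as the last box of some row of the filling. Deleting the row ends
-- therefore takes from the content exactly the part of that column outside α. To see this one must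
-- know which entries of each intermediate content are positive, so contents are functions with a
-- prescribed support.
--
-- The two extremal cases differ in l(ν). Hence ν itself tells at every hook which case holds; this
-- gives multiplicity one and also shows that different choices lead to different partitions.
-- Equality of hl(ν) with the sum makes every hook extremal, while a strict inequality at some hook
-- settles the lexicographic comparison at once.
--
-- The coefficient counts fillings that pass a Boolean test. What remains is to turn that test into
-- inequalities between contents, one row at a time, and to locate the two pieces inside the skew
-- diagram.

-- Partitions as lists of parts

partition-tail : ∀ {x xs} → IsPartition (x ∷ xs) → IsPartition xs
partition-tail (one _)    = nil
partition-tail (cons _ p) = p

partition-head>0 : ∀ {x xs} → IsPartition (x ∷ xs) → 1 ≤ x
partition-head>0 (one 1≤x)  = 1≤x
partition-head>0 (cons y≤x p) = ≤-trans (partition-head>0 p) y≤x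

partition-head≥ : ∀ {x xs} → IsPartition (x ∷ xs) → at xs 0 ≤ x
partition-head≥ (one _)      = z≤n
partition-head≥ (cons y≤x _) = y≤x

partition-∷ : ∀ {x xs} → 1 ≤ x → at xs 0 ≤ x → IsPartition xs → IsPartition (x ∷ xs)
partition-∷ {xs = []}    1≤x _   _ = one 1≤x
partition-∷ {xs = _ ∷ _} _   y≤x p = cons y≤x p

at-decreasing : ∀ {xs} → IsPartition xs → ∀ k → at xs (suc k) ≤ at xs k
at-decreasing nil          _       = z≤n
at-decreasing (one _)      zero    = z≤n
at-decreasing (one _)      (suc _) = z≤n
at-decreasing (cons y≤x _) zero    = y≤x
at-decreasing (cons _ p)   (suc k) = at-decreasing p k

at-antitone : ∀ {xs} → IsPartition xs → ∀ {j k} → j ≤ k → at xs k ≤ at xs j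
at-antitone {xs} p {j} {k} j≤k = subst (λ n → at xs n ≤ at xs j) (m∸n+n≡m j≤k) (go (k ∸ j))
  where
  go : ∀ d → at xs (d + j) ≤ at xs j
  go zero    = ≤-refl
  go (suc d) = ≤-trans (at-decreasing p (d + j)) (go d)

at-positive : ∀ {xs} → IsPartition xs → ∀ {k} → k < length xs → 1 ≤ at xs k
at-positive {_ ∷ _} p {zero}  _         = partition-head>0 p
at-positive {_ ∷ _} p {suc k} (s≤s k<n) = at-positive (partition-tail p) k<n

at-beyond : ∀ xs {k} → length xs ≤ k → at xs k ≡ 0
at-beyond []       _         = refl
at-beyond (x ∷ xs) (s≤s n≤k) = at-beyond xs n≤k

at-positive⁻ : ∀ xs {k} → 1 ≤ at xs k → k < length xs
at-positive⁻ xs {k} pos with k <? length xs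
... | yes k<n = k<n
... | no  k≮n = contradiction (subst (1 ≤_) (at-beyond xs (≮⇒≥ k≮n)) pos) λ ()

part-suc : ∀ xs k → part xs (suc k) ≡ at xs k
part-suc []       k       = refl
part-suc (x ∷ xs) zero    = refl
part-suc (x ∷ xs) (suc k) = part-suc xs k

-- Removes the first column, so that `peel xs` is the partition x ∷ xs without its first hook.
peel : List ℕ → List ℕ
peel []                 = []
peel (zero ∷ _)         = []
peel (suc zero ∷ _)     = []
peel (suc (suc x) ∷ xs) = suc x ∷ peel xs

-- `peel` discards everything from the first part 1 on. In a partition the later parts are then 1 as
-- well and would become zero, so nothing is lost.
at-peel : ∀ {xs} → IsPartition xs → ∀ k → at (peel xs) k ≡ pred (at xs k)
at-peel {[]}               p _       = refl
at-peel {zero ∷ xs}        p _       = contradiction (partition-head>0 p) λ ()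
at-peel {suc zero ∷ xs}    p zero    = refl
at-peel {suc zero ∷ xs}    p (suc k) =
  sym (m≤n⇒m∸n≡0 (≤-trans (at-antitone (partition-tail p) z≤n) (partition-head≥ p)))
at-peel {suc (suc x) ∷ xs} p zero    = refl
at-peel {suc (suc x) ∷ xs} p (suc k) = at-peel (partition-tail p) k

peel-partition : ∀ {xs} → IsPartition xs → IsPartition (peel xs)
peel-partition {[]}               p = nil
peel-partition {zero ∷ xs}        p = nil
peel-partition {suc zero ∷ xs}    p = nil
peel-partition {suc (suc x) ∷ xs} p =
  partition-∷ (s≤s z≤n)
    (subst (_≤ suc x) (sym (at-peel (partition-tail p) 0)) (pred-mono-≤ (partition-head≥ p)))
    (peel-partition (partition-tail p))

length-peel : ∀ xs → length (peel xs) ≤ length xs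
length-peel []                 = z≤n
length-peel (zero ∷ xs)        = z≤n
length-peel (suc zero ∷ xs)    = z≤n
length-peel (suc (suc x) ∷ xs) = s≤s (length-peel xs)

-- Durfee size

squareIn⇒ : ∀ xs d → T (squareIn xs d) → ∀ {i} → i < d → d ≤ at xs i
squareIn⇒ xs d sq {i} i<d = subst (d ≤_) (part-suc xs i)
  (≤ᵇ⇒≤ d _ (All.lookup (All.all⁺ _ (oneTo d) sq) (∈-map⁺ suc (∈-upTo⁺ i<d))))

squareIn⇐ : ∀ xs d → (∀ {i} → i < d → d ≤ at xs i) → T (squareIn xs d)
squareIn⇐ xs d h = All.all⁻ _ (All.tabulate λ i∈ → helper (∈-map⁻ suc i∈))
  where
  helper : ∀ {i} → ∃ (λ j → j ∈ upTo d × i ≡ suc j) → T (d ≤ᵇ part xs i)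
  helper (j , j∈ , refl) = ≤⇒≤ᵇ (subst (d ≤_) (sym (part-suc xs j)) (h (∈-upTo⁻ j∈)))

module _ (P : ℕ → Bool) where
  private
    maxSat : List ℕ → ℕ
    maxSat = foldr (λ d acc → if P d then d ⊔ acc else acc) 0

  maxSat-upper : ∀ ds {d} → d ∈ ds → T (P d) → d ≤ maxSat ds
  maxSat-upper (e ∷ ds) (here refl) Pd with P e
  ... | true = m≤m⊔n e _
  maxSat-upper (e ∷ ds) (there d∈) Pd with P e
  ... | true  = ≤-trans (maxSat-upper ds d∈ Pd) (m≤n⊔m e _)
  ... | false = maxSat-upper ds d∈ Pd

  maxSat-sat : T (P 0) → ∀ ds → T (P (maxSat ds))
  maxSat-sat P0 [] = P0
  maxSat-sat P0 (e ∷ ds) with P e in eq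
  ... | false = maxSat-sat P0 ds
  ... | true with ⊔-sel e (maxSat ds)
  ...   | inj₁ h = subst (T ∘ P) (sym h) (from T-≡ eq)
  ...   | inj₂ h = subst (T ∘ P) (sym h) (maxSat-sat P0 ds)

durfee-square : ∀ xs → T (squareIn xs (durfee xs))
durfee-square xs = maxSat-sat (squareIn xs) _ (upTo (suc (length xs)))

durfee-maximal : ∀ xs d → T (squareIn xs d) → d ≤ durfee xs
durfee-maximal xs zero    _  = z≤n
durfee-maximal xs (suc d) sq = maxSat-upper (squareIn xs) (upTo (suc (length xs))) (∈-upTo⁺ (s≤s
  (at-positive⁻ xs (≤-trans (s≤s z≤n) (squareIn⇒ xs (suc d) sq ≤-refl))))) sq

-- A square of side e + 1 consists of a first row above e further rows of length at least e + 1;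
-- without their first column these contain a square of side e.
durfee-∷ : ∀ {x xs} → IsPartition (x ∷ xs) → durfee (x ∷ xs) ≡ suc (durfee (peel xs))
durfee-∷ {x} {xs} p = ≤-antisym (shrink (durfee (x ∷ xs)) (durfee-square (x ∷ xs)))
  (durfee-maximal (x ∷ xs) _ (squareIn⇐ (x ∷ xs) _ grow))
  where
  d = durfee (peel xs)

  grow-tail : ∀ {i} → i < d → suc d ≤ at xs i
  grow-tail {i} i<d with at xs i | subst (d ≤_) (at-peel (partition-tail p) i)
                                    (squareIn⇒ (peel xs) d (durfee-square (peel xs)) i<d)
  ... | zero  | d≤ = contradiction (≤-trans i<d d≤) λ ()
  ... | suc _ | d≤ = s≤s d≤

  -- The first row is long enough because the second one is. For side 1 there is no second row, and
  -- positivity of `x` takes its place.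
  head≥ : ∀ e → (∀ {i} → i < e → suc e ≤ at xs i) → suc e ≤ x
  head≥ zero    _ = partition-head>0 p
  head≥ (suc e) h = ≤-trans (h (s≤s z≤n)) (partition-head≥ p)

  grow : ∀ {i} → i < suc d → suc d ≤ at (x ∷ xs) i
  grow {zero}  _         = head≥ d grow-tail
  grow {suc i} (s≤s i<d) = grow-tail i<d

  shrink : ∀ e → T (squareIn (x ∷ xs) e) → e ≤ suc d
  shrink zero    _  = z≤n
  shrink (suc e) sq = s≤s (durfee-maximal (peel xs) e (squareIn⇐ (peel xs) e λ {i} i<e →
    subst (e ≤_) (sym (at-peel (partition-tail p) i))
      (pred-mono-≤ (squareIn⇒ (x ∷ xs) (suc e) sq (s≤s i<e)))))

-- Principal hook lengths

conj-one : ∀ {xs} → IsPartition xs → conj xs 1 ≡ length xs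
conj-one {[]}         p = refl
conj-one {zero ∷ xs}  p = contradiction (partition-head>0 p) λ ()
conj-one {suc x ∷ xs} p = cong suc (conj-one (partition-tail p))

conj-peel : ∀ {xs} → IsPartition xs → ∀ j → conj (peel xs) (suc j) ≡ conj xs (suc (suc j))
conj-peel {[]}               p j = refl
conj-peel {zero ∷ xs}        p j = contradiction (partition-head>0 p) λ ()
conj-peel {suc zero ∷ xs}    p j = sym (none xs (partition-tail p) (partition-head≥ p))
  where
  none : ∀ ys → IsPartition ys → at ys 0 ≤ 1 → conj ys (suc (suc j)) ≡ 0
  none []                 q h = refl
  none (zero ∷ ys)        q h = contradiction (partition-head>0 q) λ ()
  none (suc zero ∷ ys)    q h = none ys (partition-tail q) (partition-head≥ q)
  none (suc (suc y) ∷ ys) q (s≤s ())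
conj-peel {suc (suc x) ∷ xs} p j with j <ᵇ suc x
... | true  = cong suc (conj-peel (partition-tail p) j)
... | false = conj-peel (partition-tail p) j

hlAt-one : ∀ {x xs} → IsPartition (x ∷ xs) → hlAt (x ∷ xs) 1 ≡ x + length xs
hlAt-one {zero}  {xs} p = contradiction (partition-head>0 p) λ ()
hlAt-one {suc x} {xs} p rewrite conj-one (partition-tail p) = +-comm (x + length xs) 1

-- Each diagonal box moves one step northwest when the first row and column are removed, and its arm
-- and leg keep their lengths.
hlAt-suc : ∀ {x xs} → IsPartition (x ∷ xs) → ∀ i →
           hlAt (x ∷ xs) (suc (suc i)) ≡ hlAt (peel xs) (suc i)
hlAt-suc {x} {xs} p i
  rewrite part-suc xs i | part-suc (peel xs) i | at-peel (partition-tail p) i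
        | conj-peel (partition-tail p) i
  with at xs i in eq
... | zero = refl
... | suc a with i <ᵇ a in i<a
...   | false = refl
-- Column `i + 2` must also count the first row of the larger partition. It does, since `x` is at
-- least the part `suc a`, which exceeds `suc i`.
...   | true with suc i <ᵇ x in i<x
...     | true = refl
...     | false = contradiction (trans (sym (to T-≡ (<⇒<ᵇ
           (<-≤-trans (s≤s (<ᵇ⇒< i a (from T-≡ i<a)))
             (subst (_≤ x) eq (≤-trans (at-antitone (partition-tail p) z≤n) (partition-head≥ p))))))) i<x) λ ()

-- The head is the arm x - 1, the leg `length xs` and the corner. All later inductions over hooks
-- use this equation.
hl-∷ : ∀ {x xs} → IsPartition (x ∷ xs) → hl (x ∷ xs) ≡ (x + length xs) ∷ hl (peel xs)
hl-∷ {x} {xs} p rewrite durfee-∷ p = cong₂ _∷_ (hlAt-one p) (begin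
  map (hlAt (x ∷ xs)) (map suc (applyUpTo suc d))   ≡⟨ cong (map (hlAt (x ∷ xs)) ∘ map suc) (sym (map-applyUpTo id suc d)) ⟩
  map (hlAt (x ∷ xs)) (map suc (map suc (upTo d)))  ≡⟨ map-∘ (map suc (upTo d)) ⟨
  map (hlAt (x ∷ xs) ∘ suc) (map suc (upTo d))      ≡⟨ map-∘ (upTo d) ⟨
  map (hlAt (x ∷ xs) ∘ suc ∘ suc) (upTo d)          ≡⟨ map-cong (hlAt-suc p) (upTo d) ⟩
  map (hlAt (peel xs) ∘ suc) (upTo d)               ≡⟨ map-∘ (upTo d) ⟩
  hl (peel xs)                                      ∎)
  where
  open ≡-Reasoning
  d = durfee (peel xs)

-- Counting letters

count-++ : ∀ k u v → count k (u ++ v) ≡ count k u + count k v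
count-++ k u v = trans (cong length (filter-++ _ u v)) (length-++ (filterᵇ (_≡ᵇ k) u))

count-reverse : ∀ k v → count k (reverse v) ≡ count k v
count-reverse k []      = refl
count-reverse k (x ∷ v) = begin
  count k (reverse (x ∷ v))           ≡⟨ cong (count k) (unfold-reverse x v) ⟩
  count k (reverse v ++ [ x ])        ≡⟨ count-++ k (reverse v) [ x ] ⟩
  count k (reverse v) + count k [ x ] ≡⟨ cong (_+ count k [ x ]) (count-reverse k v) ⟩
  count k v + count k [ x ]           ≡⟨ +-comm (count k v) _ ⟩
  count k [ x ] + count k v           ≡⟨ count-++ k [ x ] v ⟨
  count k (x ∷ v)                     ∎
  where open ≡-Reasoning

count-map-suc : ∀ k v → count (suc k) (map suc v) ≡ count k v
count-map-suc k [] = refl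
count-map-suc k (x ∷ v) with x ≡ᵇ k
... | true  = cong suc (count-map-suc k v)
... | false = count-map-suc k v

count≤length : ∀ k v → count k v ≤ length v
count≤length k v = length-filter _ v

count-none : ∀ {k} v → (∀ {x} → x ∈ v → x ≢ k) → count k v ≡ 0
count-none []          h = refl
count-none {k} (x ∷ v) h with x ≡ᵇ k in eq
... | true  = contradiction (≡ᵇ⇒≡ x k (from T-≡ eq)) (h (here refl))
... | false = count-none v (h ∘ there)

∈⇒count>0 : ∀ {k v} → k ∈ v → 1 ≤ count k v
∈⇒count>0 {k} {x ∷ v} (here refl) rewrite to T-≡ (≡⇒≡ᵇ k k refl) = s≤s z≤n
∈⇒count>0 {k} {x ∷ v} (there k∈v) with x ≡ᵇ k
... | true  = s≤s z≤n
... | false = ∈⇒count>0 k∈v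

count>0⇒∈ : ∀ {k} v → 1 ≤ count k v → k ∈ v
count>0⇒∈ {k} (x ∷ v) h with x ≡ᵇ k in eq
... | true  = here (sym (≡ᵇ⇒≡ x k (from T-≡ eq)))
... | false = there (count>0⇒∈ v h)

count-self : ∀ k → count k [ k ] ≡ 1
count-self k rewrite to T-≡ (≡⇒≡ᵇ k k refl) = refl

count-other : ∀ {k x} → x ≢ k → count k [ x ] ≡ 0
count-other {x = x} x≢k = count-none [ x ] λ { (here refl) → x≢k }

count-replicate-self : ∀ k n → count k (replicate n k) ≡ n
count-replicate-self k zero = refl
count-replicate-self k (suc n) rewrite to T-≡ (≡⇒≡ᵇ k k refl) = cong suc (count-replicate-self k n)

∈-replicate : ∀ {x k : ℕ} n → x ∈ replicate n k → x ≡ k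
∈-replicate (suc n) (here eq)  = eq
∈-replicate (suc n) (there x∈) = ∈-replicate n x∈

count-replicate-other : ∀ {k x} n → x ≢ k → count k (replicate n x) ≡ 0
count-replicate-other n x≢k = count-none _ λ y∈ y≡k → x≢k (trans (sym (∈-replicate n y∈)) y≡k)

count-full : ∀ {k} v → count k v ≡ length v → v ≡ replicate (length v) k
count-full []          _ = refl
count-full {k} (x ∷ v) h with x ≡ᵇ k in eq
... | true  = cong₂ _∷_ (≡ᵇ⇒≡ x k (from T-≡ eq)) (count-full v (suc-injective h))
... | false = contradiction (≤-trans (≤-reflexive (sym h)) (count≤length k v)) (<-irrefl refl)

at-∈ : ∀ v {j} → j < length v → at v j ∈ v
at-∈ (x ∷ v) {zero}  _         = here refl
at-∈ (x ∷ v) {suc j} (s≤s j<n) = there (at-∈ v j<n)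

∈-at : ∀ {x v} → x ∈ v → ∃ λ j → j < length v × at v j ≡ x
∈-at (here refl) = 0 , s≤s z≤n , refl
∈-at (there x∈) with j , j<n , eq ← ∈-at x∈ = suc j , s≤s j<n , eq

at-++ˡ : ∀ u v {j} → j < length u → at (u ++ v) j ≡ at u j
at-++ˡ (x ∷ u) v {zero}  _         = refl
at-++ˡ (x ∷ u) v {suc j} (s≤s j<n) = at-++ˡ u v j<n

at-last : ∀ u x → at (u ++ [ x ]) (length u) ≡ x
at-last []      x = refl
at-last (_ ∷ u) x = at-last u x

at-map-suc : ∀ v {j} → j < length v → at (map suc v) j ≡ suc (at v j)
at-map-suc (x ∷ v) {zero}  _         = refl
at-map-suc (x ∷ v) {suc j} (s≤s j<n) = at-map-suc v j<n

length-∷ʳ′ : ∀ (u : List ℕ) x → length (u ++ [ x ]) ≡ suc (length u)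
length-∷ʳ′ u x = trans (length-++ u) (+-comm (length u) 1)

-- Rows of a tableau

Sorted : List ℕ → Set
Sorted = AllPairs _≤_

sorted-++⁻ˡ : ∀ u {v} → Sorted (u ++ v) → Sorted u
sorted-++⁻ˡ []      _       = []
sorted-++⁻ˡ (x ∷ u) (h ∷ s) = All.++⁻ˡ u h ∷ sorted-++⁻ˡ u s

sorted-max-last : ∀ {v M} → Sorted v → (∀ {x} → x ∈ v → x ≤ M) → M ∈ v → ∃ λ u → v ≡ u ++ [ M ]
sorted-max-last {x ∷ []}     _       _ (here refl) = [] , refl
sorted-max-last {x ∷ y ∷ v} (h ∷ s) b (there M∈) with u , eq ← sorted-max-last s (b ∘ there) M∈ =
  x ∷ u , cong (x ∷_) eq
sorted-max-last {x ∷ y ∷ v} (h ∷ s) b (here refl)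
  with u , eq ← sorted-max-last s (b ∘ there) (here (≤-antisym (All.head h) (b (there (here refl))))) =
  x ∷ u , cong (x ∷_) eq

-- A content is a function p : ℕ → ℕ, where p k is the multiplicity of the letter suc k.
infixl 6 _⊞_
_⊞_ : (ℕ → ℕ) → List ℕ → ℕ → ℕ
(p ⊞ v) k = p k + count (suc k) v

-- For a weakly increasing row v, read from right to left after a word of content p,
-- this is the lattice condition on all prefixes ending in v: every letter suc (suc k)
-- of v is read before the first letter suc k of v.
Strip : (ℕ → ℕ) → List ℕ → Set
Strip p v = ∀ k → p (suc k) + count (suc (suc k)) v ≤ p k

Above : (ℕ → ℕ) → List ℕ → Set
Above f v = ∀ {j} → j < length v → f j < at v j

-- Tab q f p β T: the rows T form a semistandard tableau of shape β below the row f,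
-- whose reading word is a lattice word when it follows a word of content p, the
-- resulting content being q.
data Tab (q : ℕ → ℕ) : (f p : ℕ → ℕ) → List ℕ → List (List ℕ) → Set where
  []  : ∀ {f p} → p ≗ q → Tab q f p [] []
  row : ∀ {f p b bs v vs} → length v ≡ b → Sorted v → Above f v → Strip p v →
        Tab q (at v) (p ⊞ v) bs vs → Tab q f p (b ∷ bs) (v ∷ vs)

strip-cong : ∀ {p p′ v} → p ≗ p′ → Strip p v → Strip p′ v
strip-cong {v = v} e s k = subst₂ (λ a b → a + count (suc (suc k)) v ≤ b) (e (suc k)) (e k) (s k)

tab-cong : ∀ {q q′ f p p′ β T} → p ≗ p′ → q ≗ q′ → Tab q f p β T → Tab q′ f p′ β T
tab-cong ep eq ([] h) = [] λ k → trans (sym (ep k)) (trans (h k) (eq k))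
tab-cong ep eq (row {v = v} l s a st t) =
  row l s a (strip-cong {v = v} ep st) (tab-cong (λ k → cong (_+ count (suc k) v) (ep k)) eq t)

tab-increasing : ∀ {q f p β T} → Tab q f p β T → ∀ k → p k ≤ q k
tab-increasing ([] h)          k = ≤-reflexive (h k)
tab-increasing (row _ _ _ _ t) k = ≤-trans (m≤m+n _ _) (tab-increasing t k)

above-letters : ∀ {n f v} → (∀ {j} → j < length v → n ≤ f j) → Above f v → ∀ {x} → x ∈ v → suc n ≤ x
above-letters h a x∈v with j , j<n , refl ← ∈-at x∈v = ≤-<-trans (h j<n) (a j<n)

-- Below a row of positive letters every letter is at least 2, so the number of 1's is already
-- final.
tab-q0 : ∀ {q f p β T} → IsPartition β → (∀ {j} → j < at β 0 → 1 ≤ f j) → Tab q f p β T → p 0 ≡ q 0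
tab-q0 P h ([] e) = e 0
tab-q0 {p = p} P h (row {v = v} refl s a st t) = trans
  (sym (trans (cong (p 0 +_) (count-none v λ x∈ x≡1 → contradiction (subst (2 ≤_) x≡1 (above-letters h a x∈)) λ { (s≤s ()) })) (+-identityʳ _)))
  (tab-q0 (partition-tail P) (λ j< → ≤-trans (s≤s z≤n) (above-letters h a (at-∈ v (<-≤-trans j< (partition-head≥ P))))) t)

Vanishes : (ℕ → ℕ) → ℕ → Set
Vanishes p L = ∀ {k} → L ≤ k → p k ≡ 0

-- A letter `suc (suc k)` needs a letter `suc k` read before this row begins. So a single row can
-- introduce only the one new letter `suc L`.
strip-letters : ∀ {p L v} → Vanishes p L → Strip p v → ∀ {x} → x ∈ v → x ≤ suc L
strip-letters z st {zero}        _   = z≤n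
strip-letters z st {suc zero}    _   = s≤s z≤n
strip-letters {L = L} z st {suc (suc k)} x∈v with k <? L
... | yes k<L = s≤s k<L
... | no  k≮L = contradiction
  (≤-trans (∈⇒count>0 x∈v) (≤-trans (m≤n+m _ _) (≤-trans (st k) (≤-reflexive (z (≮⇒≥ k≮L)))))) λ ()

vanishes-⊞ : ∀ {p L M v} → Vanishes p L → L ≤ M → (∀ {x} → x ∈ v → x ≤ M) → Vanishes (p ⊞ v) M
vanishes-⊞ {v = v} z L≤M b {k} M≤k rewrite z (≤-trans L≤M M≤k) =
  count-none v λ x∈ x≡ → <-irrefl refl (≤-trans (subst (_≤ _) x≡ (b x∈)) M≤k)

tab-vanishes : ∀ {q f p β T L} → Vanishes p L → Tab q f p β T → Vanishes q (L + length β)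
tab-vanishes z ([] e) {k} h = trans (sym (e k)) (z (≤-trans (m≤m+n _ _) h))
tab-vanishes {L = L} z (row {bs = bs} {v = v} _ _ _ st t) {k} h =
  tab-vanishes (vanishes-⊞ {v = v} z (n≤1+n _) (strip-letters z st)) t (subst (_≤ k) (+-suc L (length bs)) h)

-- Taking predecessors lowers positive entries and leaves zeros alone. The arguments on hook removal
-- therefore have to know exactly where a content is positive.
record Support (p : ℕ → ℕ) (L : ℕ) : Set where
  field
    inside  : ∀ {k} → k < L → 1 ≤ p k
    outside : Vanishes p L
open Support

at-support : ∀ {xs} → IsPartition xs → Support (at xs) (length xs)
at-support {xs} P = record { inside = at-positive P ; outside = at-beyond xs }

support-⊞ : ∀ {p L v} → Support p L → suc L ∈ v → (∀ {x} → x ∈ v → x ≤ suc L) → Support (p ⊞ v) (suc L)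
support-⊞ {p} {L} {v} S m b = record { inside = ins ; outside = vanishes-⊞ (outside S) (n≤1+n L) b }
  where
  ins : ∀ {k} → k < suc L → 1 ≤ (p ⊞ v) k
  ins {k} (s≤s k≤L) with k ≟ L
  ... | yes refl = ≤-trans (∈⇒count>0 m) (m≤n+m _ _)
  ... | no  k≢L  = ≤-trans (inside S (≤∧≢⇒< k≤L k≢L)) (m≤m+n _ _)

-- If the final content has as many nonzero entries as the number of rows permits,
-- each row has to contribute a new letter.
tab-new-letter : ∀ {q p L bs v vs} → Vanishes p L → (∀ {x} → x ∈ v → x ≤ suc L) →
                 Tab q (at v) (p ⊞ v) bs vs → 1 ≤ q (L + length bs) → suc L ∈ v
tab-new-letter {q} {p} {L} {bs} {v} z b t pos with count (suc L) v in eq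
... | suc _ = count>0⇒∈ v (subst (1 ≤_) (sym eq) (s≤s z≤n))
... | zero  = contradiction (subst (1 ≤_) (tab-vanishes z′ t ≤-refl) pos) λ ()
  where
  z′ : Vanishes (p ⊞ v) L
  z′ {k} h with k ≟ L
  ... | yes refl rewrite z h = eq
  ... | no k≢L = vanishes-⊞ z (n≤1+n _) b (≤∧≢⇒< h (k≢L ∘ sym))

-- Removing the first principal hook

peelF : (ℕ → ℕ) → ℕ → ℕ
peelF p k = pred (p (suc k))

addEnd : ℕ → List ℕ → List ℕ
addEnd L v = map suc v ++ [ suc L ]

-- The number of rows is a separate argument because `peel` loses the rows of length one: each of
-- them comes back as the single box `suc L`.
addEnds : ℕ → ℕ → List (List ℕ) → List (List ℕ)
addEnds L zero    _        = []
addEnds L (suc n) []       = [ suc L ] ∷ addEnds (suc L) n []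
addEnds L (suc n) (v ∷ vs) = addEnd L v ∷ addEnds (suc L) n vs

length-addEnd : ∀ L v → length (addEnd L v) ≡ suc (length v)
length-addEnd L v = trans (length-∷ʳ′ (map suc v) (suc L)) (cong suc (length-map suc v))

at-addEnd : ∀ L v {j} → j < length v → at (addEnd L v) j ≡ suc (at v j)
at-addEnd L v {j} j<n = trans (at-++ˡ (map suc v) _ (subst (j <_) (sym (length-map suc v)) j<n)) (at-map-suc v j<n)

count-addEnd : ∀ k L v → count (suc k) (addEnd L v) ≡ count k v + count (suc k) [ suc L ]
count-addEnd k L v = trans (count-++ (suc k) (map suc v) _) (cong (_+ count (suc k) [ suc L ]) (count-map-suc k v))

-- Where the right-hand side drops by one, the left-hand side drops too: its content entry is
-- positive below the support bound, and for the letter `suc L` the deleted row end pays. Beyond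
-- that the content entries are zero.
peel-strip : ∀ {p L v} → Support p L → Strip p (addEnd L v) → Strip (peelF p) v
peel-strip {p} {L} {v} S st k =
  go (subst (λ c → p (2 + k) + c ≤ p (1 + k)) (count-addEnd (2 + k) L v) (st (suc k)))
  where
  lower : ∀ {a b c d} → 1 ≤ b → b + (c + d) ≤ a → pred b + c ≤ pred a
  lower {b = suc b} _ h = pred-mono-≤ (≤-trans (s≤s (+-monoʳ-≤ b (m≤m+n _ _))) h)

  lower₀ : ∀ {a b c} → b ≡ 0 → b + (c + 1) ≤ a → pred b + c ≤ pred a
  lower₀ {a} {c = c} refl h = pred-mono-≤ (subst (_≤ a) (+-comm c 1) h)

  lower₁ : ∀ {a b c d} → a ≡ 0 → b ≡ 0 → b + (c + d) ≤ a → pred b + c ≤ pred a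
  lower₁ refl refl h = ≤-trans (m≤m+n _ _) h

  go : p (2 + k) + (count (2 + k) v + count (3 + k) [ suc L ]) ≤ p (1 + k) →
       pred (p (2 + k)) + count (2 + k) v ≤ pred (p (1 + k))
  go h with <-cmp L (2 + k)
  ... | tri> _ _ L> = lower (inside S L>) h
  ... | tri≈ _ refl _ rewrite count-self (suc L) = lower₀ (outside S ≤-refl) h
  ... | tri< L< _ _ = lower₁ (outside S (≤-pred L<)) (outside S (<⇒≤ L<)) h

-- The inequality between the letters 1 and 2 is a hypothesis because `peelF` forgets `p 0`. The
-- others follow by the cases of `peel-strip` in reverse.
unpeel-strip : ∀ {p L v} → Support p L → p 1 + count 2 (addEnd L v) ≤ p 0 →
               Strip (peelF p) v → Strip p (addEnd L v)
unpeel-strip S h₀ st zero = h₀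
unpeel-strip {p} {L} {v} S h₀ st (suc k) =
  subst (λ c → p (2 + k) + c ≤ p (1 + k)) (sym (count-addEnd (2 + k) L v)) go
  where
  raise : ∀ {a b c} → 1 ≤ a → 1 ≤ b → pred b + c ≤ pred a → b + (c + 0) ≤ a
  raise {suc a} {suc b} {c} _ _ h rewrite +-identityʳ c = s≤s h

  raise₀ : ∀ {a b c} → 1 ≤ a → b ≡ 0 → pred b + c ≤ pred a → b + (c + 1) ≤ a
  raise₀ {suc a} {c = c} _ refl h rewrite +-comm c 1 = s≤s h

  raise₁ : ∀ {a b c} → b ≡ 0 → pred b + c ≤ pred a → b + (c + 0) ≤ a
  raise₁ {c = c} refl h rewrite +-identityʳ c = ≤-trans h pred[n]≤n

  go : p (2 + k) + (count (2 + k) v + count (3 + k) [ suc L ]) ≤ p (1 + k)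
  go with <-cmp L (2 + k)
  ... | tri> _ L≢ L> rewrite count-other {3 + k} {suc L} (L≢ ∘ suc-injective) =
    raise (inside S (<⇒≤ L>)) (inside S L>) (st k)
  ... | tri≈ _ refl _ rewrite count-self (suc L) = raise₀ (inside S ≤-refl) (outside S ≤-refl) (st k)
  ... | tri< L< L≢ _ rewrite count-other {3 + k} {suc L} (L≢ ∘ suc-injective) =
    raise₁ (outside S (<⇒≤ L<)) (st k)

-- Each letter loses one box with the first column. For the letters up to `L` that box is counted by
-- `p`, for `suc L` it is the end of the new row.
peelF-⊞ : ∀ {p L v} → Support p L → (∀ {x} → x ∈ v → x ≤ L) → peelF (p ⊞ addEnd L v) ≗ peelF p ⊞ v
peelF-⊞ {p} {L} {v} S b k = trans (cong (λ c → pred (p (1 + k) + c)) (count-addEnd (1 + k) L v)) go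
  where
  drop : ∀ {a c} → 1 ≤ a → pred (a + (c + 0)) ≡ pred a + c
  drop {suc a} {c} _ rewrite +-identityʳ c = refl

  drop₀ : ∀ {a c} → a ≡ 0 → pred (a + (c + 1)) ≡ pred a + c
  drop₀ {c = c} refl rewrite +-comm c 1 = refl

  drop₁ : ∀ {a c} → a ≡ 0 → c ≡ 0 → pred (a + (c + 0)) ≡ pred a + c
  drop₁ refl refl = refl

  go : pred (p (1 + k) + (count (1 + k) v + count (2 + k) [ suc L ])) ≡ pred (p (1 + k)) + count (1 + k) v
  go with <-cmp L (1 + k)
  ... | tri> _ L≢ L> rewrite count-other {2 + k} {suc L} (L≢ ∘ suc-injective) = drop (inside S L>)
  ... | tri≈ _ refl _ rewrite count-self (suc L) = drop₀ (outside S ≤-refl)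
  ... | tri< L< L≢ _ rewrite count-other {2 + k} {suc L} (L≢ ∘ suc-injective) =
    drop₁ (outside S (<⇒≤ L<)) (count-none v λ x∈ x≡ → <-irrefl refl (≤-<-trans (subst (_≤ L) x≡ (b x∈)) L<))

∈-addEnd : ∀ {L v x} → x ∈ v → suc x ∈ addEnd L v
∈-addEnd x∈v = ∈-++⁺ˡ (∈-map⁺ suc x∈v)

end∈addEnd : ∀ L v → suc L ∈ addEnd L v
end∈addEnd L v = ∈-++⁺ʳ (map suc v) (here refl)

sorted-unmap-suc : ∀ {v} → Sorted (map suc v) → Sorted v
sorted-unmap-suc s = AllPairs.map ≤-pred (AllPairs.map⁻ s)

map-suc-pred : ∀ u → (∀ {x} → x ∈ u → 1 ≤ x) → u ≡ map suc (map pred u)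
map-suc-pred []      h = refl
map-suc-pred (x ∷ u) h = cong₂ _∷_ (suc-pos (h (here refl))) (map-suc-pred u (h ∘ there))
  where
  suc-pos : ∀ {x} → 1 ≤ x → x ≡ suc (pred x)
  suc-pos (s≤s _) = refl

peel-column : ∀ {b bs} → b ≤ 1 → IsPartition (b ∷ bs) → peel bs ≡ []
peel-column {bs = []}              _   _ = refl
peel-column {bs = zero ∷ bs}       _   _ = refl
peel-column {bs = suc zero ∷ bs}   _   _ = refl
peel-column {bs = suc (suc _) ∷ _} b≤1 P = contradiction (≤-trans (partition-head≥ P) b≤1) λ { (s≤s ()) }

-- The support of `q` is as large as the number of rows permits, so by `tab-new-letter` every row
-- ends with its new letter and can be cut there. The row above is replaced by `f′`; only columns
-- that survive the cut are compared, hence `suc j` in the hypothesis.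
peel-rows : ∀ {q f p L ys T} (f′ : ℕ → ℕ) → IsPartition ys → Support p L → Support q (L + length ys) →
            (∀ {j} → suc j < at ys 0 → suc (f′ j) ≤ f j) → Tab q f p ys T →
            ∃ λ T′ → Tab (peelF q) f′ (peelF p) (peel ys) T′ × T ≡ addEnds L (length ys) T′
peel-rows f′ P Sp Sq hf ([] e) = [] , [] (λ k → cong pred (e (suc k))) , refl
peel-rows {q} {f} {p} {L} {b ∷ bs} f′ P Sp Sq hf (row {v = v} {vs = vs} len so ab st t) =
  result (sorted-max-last so letters (tab-new-letter (outside Sp) letters t (inside Sq top)))
  where
  letters : ∀ {x} → x ∈ v → x ≤ suc L
  letters = strip-letters (outside Sp) st

  top : L + length bs < L + suc (length bs)
  top = +-monoʳ-< L ≤-refl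

  Sq′ : Support q (suc L + length bs)
  Sq′ = subst (Support q) (+-suc L (length bs)) Sq

  result : ∃ (λ u → v ≡ u ++ [ suc L ]) →
           ∃ λ T′ → Tab (peelF q) f′ (peelF p) (peel (b ∷ bs)) T′ × v ∷ vs ≡ addEnds L (suc (length bs)) T′
  result (u , refl) = assemble b len P hf (map pred u) (map-suc-pred u positive)
    where
    positive : ∀ {x} → x ∈ u → 1 ≤ x
    positive x∈u with j , j<n , refl ← ∈-at x∈u =
      subst (1 ≤_) (at-++ˡ u _ j<n) (≤-trans (s≤s z≤n) (ab (subst (j <_) (sym (length-∷ʳ′ u (suc L))) (m<n⇒m<1+n j<n))))

    assemble : ∀ b → length (u ++ [ suc L ]) ≡ b → IsPartition (b ∷ bs) →
               (∀ {j} → suc j < b → suc (f′ j) ≤ f j) → ∀ v′ → u ≡ map suc v′ →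
               ∃ λ T′ → Tab (peelF q) f′ (peelF p) (peel (b ∷ bs)) T′ ×
                        (u ++ [ suc L ]) ∷ vs ≡ addEnds L (suc (length bs)) T′
    assemble b len P hf v′ refl = finish b (trans (sym len) (length-addEnd L v′)) P
      where
      bound : ∀ {x} → x ∈ v′ → x ≤ L
      bound x∈ = ≤-pred (letters (∈-addEnd {L} x∈))

      ab′ : Above f′ v′
      ab′ {j} j<n = ≤-pred (≤-trans (s≤s (hf (subst (suc j <_) (trans (sym (length-addEnd L v′)) len) (s≤s j<n))))
        (subst (suc (f j) ≤_) (at-addEnd L v′ j<n) (ab (subst (j <_) (sym (length-addEnd L v′)) (m<n⇒m<1+n j<n)))))

      rec = peel-rows (at v′) (partition-tail P) (support-⊞ Sp (end∈addEnd L v′) letters) Sq′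
        (λ {j} h → ≤-reflexive (sym (at-addEnd L v′ (≤-pred (subst (suc j <_) (trans (sym len) (length-addEnd L v′))
          (<-≤-trans h (partition-head≥ P))))))) t

      finish : ∀ b → b ≡ suc (length v′) → IsPartition (b ∷ bs) →
               ∃ λ T′ → Tab (peelF q) f′ (peelF p) (peel (b ∷ bs)) T′ ×
                        addEnd L v′ ∷ vs ≡ addEnds L (suc (length bs)) T′
      finish zero       ()
      -- A row of length one vanishes, and so do all rows below it. The recursive tableau is then
      -- empty, and only its equation of contents is kept.
      finish (suc zero) e P with T″ , t″ , vs≡ ← rec = column t″ vs≡ (empty v′ (suc-injective (sym e)))
        where
        empty : ∀ (u : List ℕ) → length u ≡ 0 → u ≡ []
        empty [] _ = refl

        column : ∀ {T″} → Tab (peelF q) (at v′) (peelF (p ⊞ addEnd L v′)) (peel bs) T″ →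
                 vs ≡ addEnds (suc L) (length bs) T″ → v′ ≡ [] →
                 ∃ λ T′ → Tab (peelF q) f′ (peelF p) [] T′ × addEnd L v′ ∷ vs ≡ addEnds L (suc (length bs)) T′
        column t″ vs≡ v′≡[] with peel bs | peel-column ≤-refl P | t″
        ... | _ | refl | [] e″ = [] ,
          [] (λ k → trans (sym (+-identityʳ _)) (trans (cong (λ u → peelF p k + count (suc k) u) (sym v′≡[]))
                      (trans (sym (peelF-⊞ Sp bound k)) (e″ k)))) ,
          cong₂ _∷_ (cong (addEnd L) v′≡[]) vs≡
      finish (suc (suc c)) e P with T″ , t″ , vs≡ ← rec = v′ ∷ T″ ,
        row (suc-injective (sym e)) (sorted-unmap-suc (sorted-++⁻ˡ (map suc v′) so)) ab′ (peel-strip {v = v′} Sp st)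
          (tab-cong (peelF-⊞ Sp bound) (λ _ → refl) t″) ,
        cong (addEnd L v′ ∷_) vs≡

-- `pred` identifies 0 and 1; a common support separates them again.
support-unpeel : ∀ {p q L} → Support p L → Support q L → p 0 ≡ q 0 → peelF p ≗ peelF q → p ≗ q
support-unpeel Sp Sq e₀ e zero = e₀
support-unpeel {p} {q} {L} Sp Sq e₀ e (suc k) with suc k <? L
... | yes k<L = pred-injective′ (inside Sp k<L) (inside Sq k<L) (e k)
  where
  pred-injective′ : ∀ {a b} → 1 ≤ a → 1 ≤ b → pred a ≡ pred b → a ≡ b
  pred-injective′ (s≤s _) (s≤s _) = cong suc
... | no k≮L = trans (outside Sp (≮⇒≥ k≮L)) (sym (outside Sq (≮⇒≥ k≮L)))

-- The hypotheses on `p 0`, `q 0` and `q 1` restore what `peelF` forgets about the letter 1. The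
-- bound `f j ≤ L` makes the new row end exceed the entry above it.
unpeel-rows : ∀ {q q′ f f′ p p′ L ys T′} → IsPartition ys → 1 ≤ L → Support p L → Support q (L + length ys) →
              p 0 ≡ q 0 → q 1 ≤ q 0 → (∀ k → q′ (suc k) ≤ q′ k) → peelF q ≗ q′ → peelF p ≗ p′ →
              (∀ {j} → suc j < at ys 0 → f j ≡ suc (f′ j)) → (∀ {j} → f j ≤ L) →
              Tab q′ f′ p′ (peel ys) T′ → Tab q f p ys (addEnds L (length ys) T′)
unpeel-rows {ys = []} {T′} P 1≤L Sp Sq e₀ h₀ dq eq ep hf bf ([] e) =
  [] (support-unpeel Sp (subst (Support _) (+-identityʳ _) Sq) e₀ λ k → trans (ep k) (trans (e k) (sym (eq k))))
unpeel-rows {q} {q′} {f} {f′} {p} {p′} {L} {b ∷ bs} P 1≤L Sp Sq e₀ h₀ dq eq ep hf bf t = go b P hf t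
  where
  Sq′ : Support q (suc L + length bs)
  Sq′ = subst (Support q) (+-suc L (length bs)) Sq

  step : ∀ {b T″} v′ → suc (length v′) ≡ b → IsPartition (b ∷ bs) → Sorted v′ → Above f′ v′ → Strip p′ v′ →
         (∀ {j} → suc j < b → f j ≡ suc (f′ j)) → Tab q′ (at v′) (p′ ⊞ v′) (peel bs) T″ →
         Tab q f p (b ∷ bs) (addEnd L v′ ∷ addEnds (suc L) (length bs) T″)
  step {b} {T″} v′ len P so ab st hf t″ =
    row (trans (length-addEnd L v′) len) sorted above strip rest
    where
    stp : Strip (peelF p) v′
    stp = strip-cong {v = v′} (sym ∘ ep) st

    vanP : Vanishes (peelF p) (pred L)
    vanP {k} h = cong pred (outside Sp (≤-trans (suc-pred≥ L) (s≤s h)))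
      where
      suc-pred≥ : ∀ n → n ≤ suc (pred n)
      suc-pred≥ zero    = z≤n
      suc-pred≥ (suc n) = ≤-refl

    -- The peeled content vanishes from `pred L` on, so the letters are at most `suc (pred L)`,
    -- which is `L` because `1 ≤ L`.
    bound : ∀ {x} → x ∈ v′ → x ≤ L
    bound x∈ = ≤-trans (strip-letters vanP stp x∈) (≤-reflexive (suc-pred′ 1≤L))
      where
      suc-pred′ : ∀ {n} → 1 ≤ n → suc (pred n) ≡ n
      suc-pred′ (s≤s _) = refl

    letters : ∀ {x} → x ∈ addEnd L v′ → x ≤ suc L
    letters x∈ with ∈-++⁻ (map suc v′) x∈
    ... | inj₂ (here refl) = ≤-refl
    ... | inj₁ x∈′ with y , y∈ , refl ← ∈-map⁻ suc x∈′ = s≤s (bound y∈)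

    sorted : Sorted (addEnd L v′)
    sorted = AllPairs.++⁺ (AllPairs.map⁺ (AllPairs.map s≤s so)) ([] ∷ [])
      (All.map⁺ (All.tabulate λ x∈ → s≤s (bound x∈) ∷ []))

    above : Above f (addEnd L v′)
    above {j} j< with m≤n⇒m<n∨m≡n (≤-pred (subst (j <_) (length-addEnd L v′) j<))
    ... | inj₁ j<n = subst₂ _<_ (sym (hf (subst (suc j <_) len (s≤s j<n)))) (sym (at-addEnd L v′ j<n)) (s≤s (ab j<n))
    ... | inj₂ j≡ = subst (f j <_)
      (sym (trans (cong (at (addEnd L v′)) (trans j≡ (sym (length-map suc v′)))) (at-last (map suc v′) (suc L)))) (s≤s bf)

    two≤ : ∀ {x} → x ∈ addEnd L v′ → 2 ≤ x
    two≤ x∈ with ∈-++⁻ (map suc v′) x∈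
    ... | inj₂ (here refl) = s≤s 1≤L
    ... | inj₁ x∈′ with y , y∈ , refl ← ∈-map⁻ suc x∈′ = s≤s (above-letters (λ _ → z≤n) ab y∈)

    no-one : count 1 (addEnd L v′) ≡ 0
    no-one = count-none (addEnd L v′) λ x∈ x≡ → contradiction (subst (2 ≤_) x≡ (two≤ x∈)) λ { (s≤s ()) }

    rest : Tab q (at (addEnd L v′)) (p ⊞ addEnd L v′) bs (addEnds (suc L) (length bs) T″)
    rest = unpeel-rows (partition-tail P) (m≤n⇒m≤1+n 1≤L) (support-⊞ Sp (end∈addEnd L v′) letters) Sq′
      (trans (trans (cong (p 0 +_) no-one) (+-identityʳ _)) e₀) h₀ dq eq
      (λ k → trans (peelF-⊞ Sp bound k) (cong (_+ count (suc k) v′) (ep k)))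
      (λ {j} h → at-addEnd L v′ (≤-pred (subst (suc j <_) (sym len) (<-≤-trans h (partition-head≥ P)))))
      at-bound t″
      where
      at-bound : ∀ {j} → at (addEnd L v′) j ≤ suc L
      at-bound {j} with j <? length (addEnd L v′)
      ... | yes j< = letters (at-∈ (addEnd L v′) j<)
      ... | no  j≮ rewrite at-beyond (addEnd L v′) (≮⇒≥ j≮) = z≤n

    -- The inequality between the letters 1 and 2 comes from the end of the tableau: the left-hand
    -- side can only grow to `q 1`, and `q 1 ≤ q 0 = p 0`.
    strip : Strip p (addEnd L v′)
    strip = unpeel-strip {v = v′} Sp (≤-trans (tab-increasing rest 1) (≤-trans h₀ (≤-reflexive (sym e₀)))) stp

  go : ∀ b {T′} → IsPartition (b ∷ bs) → (∀ {j} → suc j < b → f j ≡ suc (f′ j)) →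
       Tab q′ f′ p′ (peel (b ∷ bs)) T′ → Tab q f p (b ∷ bs) (addEnds L (suc (length bs)) T′)
  go zero    P hf t = contradiction (partition-head>0 P) λ ()
  -- Here the peeled row is empty. Its strip condition says that `p′` decreases, which holds because
  -- `p′` agrees with `q′`.
  go (suc zero) P hf ([] e) = step [] refl P [] (λ ()) strip₀ hf
      (subst (λ β → Tab q′ (at []) (p′ ⊞ []) β []) (sym (peel-column ≤-refl P)) ([] λ k → trans (+-identityʳ _) (e k)))
    where
    strip₀ : Strip p′ []
    strip₀ k rewrite +-identityʳ (p′ (suc k)) | e (suc k) | e k = dq k
  go (suc (suc c)) P hf (row {v = v′} len so ab st t) = step v′ (cong suc len) P so ab st hf t

-- Tableaux with a first hook of maximal length

-- The upper piece has been read already and contributes the initial content `at α`. The row of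
-- zeros on top only demands positive letters.
LR : List ℕ → List ℕ → List ℕ → List (List ℕ) → Set
LR α β ν T = Tab (at ν) (λ _ → 0) (at α) β T

-- Here `l` counts the rows of α below its first, so `2 + l` is the first letter not in α. If the
-- first row already uses it, the ends of the lower rows start one later.
wide tall : ℕ → ℕ → ℕ → List (List ℕ) → List (List ℕ)
wide y l n T = replicate y 1 ∷ addEnds (1 + l) n T
tall y l n T = (replicate (pred y) 1 ++ [ 2 + l ]) ∷ addEnds (2 + l) n T

strip-replicate-one : ∀ {p} n → (∀ k → p (suc k) ≤ p k) → Strip p (replicate n 1)
strip-replicate-one {p} n d k
  rewrite count-replicate-other {suc (suc k)} {1} n (λ ()) | +-identityʳ (p (suc k)) = d k

at-replicate : ∀ {x} n {j} → at (replicate n x) j ≤ x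
at-replicate zero            = z≤n
at-replicate (suc n) {zero}  = ≤-refl
at-replicate (suc n) {suc j} = at-replicate n

at-replicate-< : ∀ {x} n {j} → j < n → at (replicate n x) j ≡ x
at-replicate-< (suc n) {zero}  _         = refl
at-replicate-< (suc n) {suc j} (s≤s j<n) = at-replicate-< n j<n

sorted-replicate : ∀ n x → Sorted (replicate n x)
sorted-replicate zero    x = []
sorted-replicate (suc n) x = All.replicate⁺ n ≤-refl ∷ sorted-replicate n x

module _ {x xs y ys z zs} (Pα : IsPartition (x ∷ xs)) (Pβ : IsPartition (y ∷ ys)) (Pν : IsPartition (z ∷ zs)) where

  private
    l = length xs
    n = length ys

    Sα : Support (at (x ∷ xs)) (suc l)
    Sα = at-support Pα

    tall-row : List ℕ
    tall-row = replicate (pred y) 1 ++ [ 2 + l ]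

    length-tall-row : length tall-row ≡ y
    length-tall-row = trans (length-∷ʳ′ (replicate (pred y) 1) (2 + l))
      (trans (cong suc (length-replicate (pred y))) (suc-pred y {{>-nonZero (partition-head>0 Pβ)}}))

    count-tall-row : ∀ k → count (2 + k) tall-row ≡ count (2 + k) [ 2 + l ]
    count-tall-row k = trans (count-++ (2 + k) (replicate (pred y) 1) _)
      (cong (_+ count (2 + k) [ 2 + l ]) (count-replicate-other (pred y) λ ()))

    wide-support : Support (at (x ∷ xs) ⊞ replicate y 1) (1 + l)
    wide-support = record
      { inside  = λ k< → ≤-trans (inside Sα k<) (m≤m+n _ _)
      ; outside = vanishes-⊞ {v = replicate y 1} (outside Sα) ≤-refl λ a∈ → ≤-trans (≤-reflexive (∈-replicate y a∈)) (s≤s z≤n) }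

    tall-letters : ∀ {a} → a ∈ tall-row → a ≤ 2 + l
    tall-letters a∈ with ∈-++⁻ (replicate (pred y) 1) a∈
    ... | inj₁ a∈′         = ≤-trans (≤-reflexive (∈-replicate (pred y) a∈′)) (s≤s z≤n)
    ... | inj₂ (here refl) = ≤-refl

    tall-support : Support (at (x ∷ xs) ⊞ tall-row) (2 + l)
    tall-support = support-⊞ {v = tall-row} Sα (∈-++⁺ʳ (replicate (pred y) 1) (here refl)) tall-letters

    wide-peel : peelF (at (x ∷ xs) ⊞ replicate y 1) ≗ at (peel xs)
    wide-peel k rewrite count-replicate-other {2 + k} {1} y (λ ()) | +-identityʳ (at xs k) =
      sym (at-peel (partition-tail Pα) k)

    -- The single letter `2 + l` is the bottom box of the first column of the content, and `pred`
    -- removes it.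
    tall-peel : peelF (at (x ∷ xs) ⊞ tall-row) ≗ at (peel xs)
    tall-peel k rewrite count-tall-row k | at-peel (partition-tail Pα) k with k ≟ l
    ... | yes refl rewrite at-beyond xs {l} ≤-refl | count-self (2 + l) = refl
    ... | no  k≢l rewrite count-other {2 + k} {2 + l} (λ e → k≢l (sym (suc-injective (suc-injective e)))) | +-identityʳ (at xs k) = refl

    peel-ν : peelF (at (z ∷ zs)) ≗ at (peel zs)
    peel-ν k = sym (at-peel (partition-tail Pν) k)

    -- After the first row is deleted nothing lies above the remaining rows, so they are compared
    -- with zeros; for this it suffices that the deleted letters were positive.
    rest-peeled : ∀ {v vs} L → length v ≡ y → (∀ {a} → a ∈ v → 1 ≤ a) → Support (at (x ∷ xs) ⊞ v) L →
                  peelF (at (x ∷ xs) ⊞ v) ≗ at (peel xs) → suc (length zs) ≡ L + n →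
                  Tab (at (z ∷ zs)) (at v) (at (x ∷ xs) ⊞ v) ys vs →
                  ∃ λ T′ → LR (peel xs) (peel ys) (peel zs) T′ × vs ≡ addEnds L n T′
    rest-peeled {v} L len pos S pe e t
      with T′ , t′ , vs≡ ← peel-rows (λ _ → 0) (partition-tail Pβ) S (subst (Support _) e (at-support Pν))
             (λ {j} h → pos (at-∈ v (subst (j <_) (sym len) (<-≤-trans (<⇒≤ h) (partition-head≥ Pβ))))) t
      = T′ , tab-cong pe peel-ν t′ , vs≡

  first-row : ∀ {v vs} → LR (x ∷ xs) (y ∷ ys) (z ∷ zs) (v ∷ vs) → z ≡ x + count 1 v
  first-row (row {v = v} refl so ab st t) = sym (tab-q0 (partition-tail Pβ)
    (λ j< → above-letters (λ _ → z≤n) ab (at-∈ v (<-≤-trans j< (partition-head≥ Pβ)))) t)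

  -- Every row introduces at most one letter, which bounds `length zs`. Attaining the bound costs
  -- the first row one letter 1. Both pairs of bounds have the same sum, by `wide-sum` and
  -- `tall-sum`.
  first-hook-cases : ∀ {v vs} → LR (x ∷ xs) (y ∷ ys) (z ∷ zs) (v ∷ vs) →
    (z ≤ x + y × length zs ≤ l + n) ⊎
    (z ≤ x + pred y × length zs ≡ suc (l + n) × ∃ λ u → v ≡ u ++ [ 2 + l ])
  first-hook-cases t₀@(row {v = v} refl so ab st t) with m≤n⇒m<n∨m≡n zs≤
    where
    zs≤ : length zs ≤ suc (l + n)
    zs≤ with length zs ≤? suc (l + n)
    ... | yes h = h
    ... | no  h = contradiction (subst (1 ≤_)
      (tab-vanishes (outside Sα) t₀ (subst (_≤ length zs) (cong suc (sym (+-suc l n))) (≰⇒> h)))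
      (at-positive Pν ≤-refl)) λ ()
  ... | inj₁ zs< = inj₁ (subst (_≤ x + y) (sym (first-row t₀)) (+-monoʳ-≤ x (count≤length 1 v)) , ≤-pred zs<)
  ... | inj₂ zs≡ with u , refl ← sorted-max-last so (strip-letters (outside Sα) st)
                       (tab-new-letter {bs = ys} (outside Sα) (strip-letters (outside Sα) st) t
                         (subst (λ k → 1 ≤ at (z ∷ zs) k) zs≡ (at-positive Pν ≤-refl))) =
    inj₂ (subst (_≤ x + pred y) (sym (first-row t₀)) (+-monoʳ-≤ x bound) , zs≡ , u , refl)
    where
    bound : count 1 (u ++ [ 2 + l ]) ≤ pred (length (u ++ [ 2 + l ]))
    bound rewrite count-++ 1 u [ 2 + l ] | +-identityʳ (count 1 u) | length-∷ʳ′ u (2 + l) = count≤length 1 u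

  wide-first-row : ∀ {v vs} → LR (x ∷ xs) (y ∷ ys) (z ∷ zs) (v ∷ vs) → z ≡ x + y → length zs ≡ l + n →
                   ∃ λ T′ → LR (peel xs) (peel ys) (peel zs) T′ × v ∷ vs ≡ wide y l n T′
  wide-first-row {v} t₀@(row refl so ab st t) z≡ zs≡
    with count-full v (+-cancelˡ-≡ x _ _ (trans (sym (first-row t₀)) z≡))
  ... | v≡ with T′ , t′ , vs≡ ← rest-peeled {v} (1 + l) refl (above-letters (λ _ → z≤n) ab)
                  (subst (λ u → Support (at (x ∷ xs) ⊞ u) (1 + l)) (sym v≡) wide-support)
                  (subst (λ u → peelF (at (x ∷ xs) ⊞ u) ≗ at (peel xs)) (sym v≡) wide-peel) (cong suc zs≡) t
    = T′ , t′ , cong₂ _∷_ v≡ vs≡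

  tall-first-row : ∀ {u vs} → LR (x ∷ xs) (y ∷ ys) (z ∷ zs) ((u ++ [ 2 + l ]) ∷ vs) → z ≡ x + pred y →
                   length zs ≡ suc (l + n) →
                   ∃ λ T′ → LR (peel xs) (peel ys) (peel zs) T′ × (u ++ [ 2 + l ]) ∷ vs ≡ tall y l n T′
  tall-first-row {u} t₀@(row refl so ab st t) z≡ zs≡ with v≡
    where
    full : count 1 u ≡ length u
    full = begin
      count 1 u                        ≡⟨ +-identityʳ _ ⟨
      count 1 u + 0                    ≡⟨ count-++ 1 u [ 2 + l ] ⟨
      count 1 (u ++ [ 2 + l ])         ≡⟨ +-cancelˡ-≡ x _ _ (trans (sym (first-row t₀)) z≡) ⟩
      pred (length (u ++ [ 2 + l ]))   ≡⟨ cong pred (length-∷ʳ′ u (2 + l)) ⟩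
      length u                         ∎
      where open ≡-Reasoning

    v≡ : u ++ [ 2 + l ] ≡ tall-row
    v≡ = cong (_++ [ 2 + l ]) (trans (count-full u full) (cong (λ m → replicate m 1) (sym (cong pred (length-∷ʳ′ u (2 + l))))))
  ... | v≡ with T′ , t′ , vs≡ ← rest-peeled {u ++ [ 2 + l ]} (2 + l) refl (above-letters (λ _ → z≤n) ab)
                  (subst (λ v → Support (at (x ∷ xs) ⊞ v) (2 + l)) (sym v≡) tall-support)
                  (subst (λ v → peelF (at (x ∷ xs) ⊞ v) ≗ at (peel xs)) (sym v≡) tall-peel) (cong suc zs≡) t
    = T′ , t′ , cong₂ _∷_ v≡ vs≡

  private
    wide-tableau : ∀ {T′} → z ≡ x + y → length zs ≡ l + n → LR (peel xs) (peel ys) (peel zs) T′ →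
                   LR (x ∷ xs) (y ∷ ys) (z ∷ zs) (wide y l n T′)
    wide-tableau z≡ zs≡ t = row (length-replicate y) (sorted-replicate y 1)
      (λ {j} j< → ≤-reflexive (sym (at-replicate-< y (subst (j <_) (length-replicate y) j<))))
      (strip-replicate-one y (at-decreasing Pα))
      (unpeel-rows (partition-tail Pβ) (s≤s z≤n) wide-support (subst (Support _) (cong suc zs≡) (at-support Pν))
        (trans (cong (x +_) (count-replicate-self 1 y)) (sym z≡)) (at-decreasing Pν 0)
        (at-decreasing (peel-partition (partition-tail Pν))) peel-ν wide-peel
        (λ h → at-replicate-< y (<-≤-trans (<⇒≤ h) (partition-head≥ Pβ)))
        (≤-trans (at-replicate y) (s≤s z≤n)) t)

    tall-tableau : ∀ {T′} → z ≡ x + pred y → length zs ≡ suc (l + n) → LR (peel xs) (peel ys) (peel zs) T′ →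
                   LR (x ∷ xs) (y ∷ ys) (z ∷ zs) (tall y l n T′)
    tall-tableau z≡ zs≡ t = row length-tall-row
      (AllPairs.++⁺ (sorted-replicate (pred y) 1) ([] ∷ []) (All.replicate⁺ (pred y) (s≤s z≤n ∷ [])))
      (λ j< → positive (at-∈ tall-row j<)) strip
      (unpeel-rows (partition-tail Pβ) (s≤s z≤n) tall-support (subst (Support _) (cong suc zs≡) (at-support Pν))
        (trans (cong (x +_) count-one) (sym z≡)) (at-decreasing Pν 0)
        (at-decreasing (peel-partition (partition-tail Pν))) peel-ν tall-peel
        (λ {j} h → let j<y = <-≤-trans (pred-mono-≤ h) (pred-mono-≤ (partition-head≥ Pβ)) in
          trans (at-++ˡ (replicate (pred y) 1) _ (subst (j <_) (sym (length-replicate (pred y))) j<y))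
            (at-replicate-< (pred y) j<y))
        at-bound t)
      where
      positive : ∀ {a} → a ∈ tall-row → 1 ≤ a
      positive a∈ with ∈-++⁻ (replicate (pred y) 1) a∈
      ... | inj₁ a∈′         = ≤-reflexive (sym (∈-replicate (pred y) a∈′))
      ... | inj₂ (here refl) = s≤s z≤n

      count-one : count 1 tall-row ≡ pred y
      count-one = trans (count-++ 1 (replicate (pred y) 1) _)
        (trans (+-identityʳ _) (count-replicate-self 1 (pred y)))

      at-bound : ∀ {j} → at tall-row j ≤ 2 + l
      at-bound {j} with j <? length tall-row
      ... | yes j< = tall-letters (at-∈ tall-row j<)
      ... | no  j≮ rewrite at-beyond tall-row (≮⇒≥ j≮) = z≤n

      strip : Strip (at (x ∷ xs)) tall-row
      strip k rewrite count-tall-row k with k ≟ l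
      ... | yes refl rewrite at-beyond xs {l} ≤-refl | count-self (2 + l) = inside Sα ≤-refl
      ... | no  k≢l rewrite count-other {2 + k} {2 + l} (λ e → k≢l (sym (suc-injective (suc-injective e)))) | +-identityʳ (at xs k) =
        at-decreasing Pα k

  data Extremal : Set where
    is-wide : z ≡ x + y → length zs ≡ l + n → Extremal
    is-tall : z ≡ x + pred y → length zs ≡ suc (l + n) → Extremal

  attach : Extremal → List (List ℕ) → List (List ℕ)
  attach (is-wide _ _) = wide y l n
  attach (is-tall _ _) = tall y l n

  -- The length of `zs` tells the cases apart, so ν fixes the first row and all row ends of its
  -- filling. Multiplicity one rests on this.
  attach-irrelevant : ∀ e e′ T → attach e T ≡ attach e′ T
  attach-irrelevant (is-wide _ _) (is-wide _ _) T = refl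
  attach-irrelevant (is-tall _ _) (is-tall _ _) T = refl
  attach-irrelevant (is-wide _ a) (is-tall _ b) T = contradiction (trans (sym a) b) (<⇒≢ ≤-refl)
  attach-irrelevant (is-tall _ a) (is-wide _ b) T = contradiction (trans (sym b) a) (<⇒≢ ≤-refl)

  attach-LR : ∀ e {T′} → LR (peel xs) (peel ys) (peel zs) T′ → LR (x ∷ xs) (y ∷ ys) (z ∷ zs) (attach e T′)
  attach-LR (is-wide a b) = wide-tableau a b
  attach-LR (is-tall a b) = tall-tableau a b

  private
    wide-sum : (x + y) + (l + n) ≡ (x + l) + (y + n)
    wide-sum = interchange +-commutativeSemigroup x y l n

    tall-sum : (x + pred y) + suc (l + n) ≡ (x + l) + (y + n)
    tall-sum = trans (+-suc (x + pred y) (l + n)) (trans (cong (_+ (l + n))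
      (trans (sym (+-suc x (pred y))) (cong (x +_) (suc-pred y {{>-nonZero (partition-head>0 Pβ)}})))) wide-sum)

    +-tight : ∀ {a b c d} → a ≤ b → c ≤ d → a + c ≡ b + d → a ≡ b × c ≡ d
    +-tight {a} {b} {c} {d} a≤b c≤d e with m≤n⇒m<n∨m≡n a≤b
    ... | inj₁ a<b  = contradiction e (<⇒≢ (+-mono-<-≤ a<b c≤d))
    ... | inj₂ refl = refl , +-cancelˡ-≡ a c d e

  first-hook-bound : ∀ {T} → LR (x ∷ xs) (y ∷ ys) (z ∷ zs) T → z + length zs ≤ (x + l) + (y + n)
  first-hook-bound t@(row _ _ _ _ _) with first-hook-cases t
  ... | inj₁ (a , b)        = ≤-trans (+-mono-≤ a b) (≤-reflexive wide-sum)
  ... | inj₂ (a , b , _)    = ≤-trans (+-mono-≤ a (≤-reflexive b)) (≤-reflexive tall-sum)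

  detach : ∀ {T} → LR (x ∷ xs) (y ∷ ys) (z ∷ zs) T → z + length zs ≡ (x + l) + (y + n) →
           Σ Extremal λ e → ∃ λ T′ → LR (peel xs) (peel ys) (peel zs) T′ × T ≡ attach e T′
  detach t@(row _ _ _ _ _) eq with first-hook-cases t
  ... | inj₁ (a , b) with a′ , b′ ← +-tight a b (trans eq (sym wide-sum)) =
    is-wide a′ b′ , wide-first-row t a′ b′
  ... | inj₂ (a , b , u , refl) with a′ ← +-cancelʳ-≡ _ z (x + pred y) (trans (cong (z +_) (sym b)) (trans eq (sym tall-sum))) =
    is-tall a′ b , tall-first-row t a′ b

  extremal-hook : Extremal → z + length zs ≡ (x + l) + (y + n)
  extremal-hook (is-wide a b) = trans (cong₂ _+_ a b) wide-sum
  extremal-hook (is-tall a b) = trans (cong₂ _+_ a b) tall-sum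

-- Superstandard tableaux: the case in which one of the two partitions is empty

super : ℕ → List ℕ → List (List ℕ)
super i []       = []
super i (b ∷ bs) = replicate b (suc i) ∷ super (suc i) bs

all-equal : ∀ {k : ℕ} v → (∀ {x} → x ∈ v → x ≡ k) → v ≡ replicate (length v) k
all-equal []      h = refl
all-equal (x ∷ v) h = cong₂ _∷_ (h (here refl)) (all-equal v (h ∘ there))

-- The letters of the first row are at least `suc i` by the columns and at most `suc i` by
-- `strip-letters`; the next row is in the same position with `suc i`. For `i = 0` this also
-- determines the filling of the upper piece.
tab-super : ∀ {q f p β T} i → IsPartition β → (∀ {j} → j < at β 0 → i ≤ f j) → Vanishes p i → Tab q f p β T →
            T ≡ super i β × (∀ {k} → k < i → q k ≡ p k) × (∀ k → q (i + k) ≡ at β k)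
tab-super i P hf z ([] e) = refl , (λ {k} _ → sym (e k)) , λ k → trans (sym (e (i + k))) (z (m≤m+n i k))
tab-super {q} {f} {p} {b ∷ bs} i P hf z (row {v = v} {vs = vs} refl so ab st t)
  with tab-super (suc i) (partition-tail P)
         (λ j< → above-letters hf ab (at-∈ v (<-≤-trans j< (partition-head≥ P))))
         (vanishes-⊞ {v = v} z (n≤1+n i) (strip-letters z st)) t
... | T≡ , low , high = cong₂ _∷_ v≡ T≡ , low′ , high′
  where
  v≡ : v ≡ replicate (length v) (suc i)
  v≡ = all-equal v λ x∈ → ≤-antisym (strip-letters z st x∈) (above-letters hf ab x∈)

  low′ : ∀ {k} → k < i → q k ≡ p k
  low′ {k} k<i = trans (low (m<n⇒m<1+n k<i)) (trans (cong (λ u → p k + count (suc k) u) v≡)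
    (trans (cong (p k +_) (count-replicate-other (length v) (λ e → <-irrefl (suc-injective (sym e)) k<i))) (+-identityʳ _)))

  high′ : ∀ k → q (i + k) ≡ at (length v ∷ bs) k
  high′ zero rewrite +-identityʳ i = trans (low ≤-refl) (trans (cong₂ _+_ (z ≤-refl) (cong (count (suc i)) v≡))
    (count-replicate-self (suc i) (length v)))
  high′ (suc k) = trans (cong q (+-suc i k)) (high k)

strip-decreasing : ∀ {p v} → Strip p v → ∀ k → (p ⊞ v) (suc k) ≤ (p ⊞ v) k
strip-decreasing st k = ≤-trans (st k) (m≤m+n _ _)

-- `at β 0 ≤ p k` for `k < i` says that the rows already placed are at least as long as the next
-- one, so a new letter never outnumbers its predecessor.
super-tab : ∀ {q f p β} i → IsPartition β → (∀ {j} → f j ≤ i) → Vanishes p i → (∀ k → p (suc k) ≤ p k) →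
            (∀ {k} → k < i → at β 0 ≤ p k) → (∀ {k} → k < i → q k ≡ p k) → (∀ k → q (i + k) ≡ at β k) →
            Tab q f p β (super i β)
super-tab {q} {f} {p} {[]} i P hf z dp hp low high = [] agree
  where
  agree : p ≗ q
  agree k with k <? i
  ... | yes k<i = sym (low k<i)
  ... | no  k≮i = trans (z (≮⇒≥ k≮i)) (sym (trans (cong q (sym (m+[n∸m]≡n (≮⇒≥ k≮i)))) (high (k ∸ i))))
super-tab {q} {f} {p} {b ∷ bs} i P hf z dp hp low high =
  row (length-replicate b) (sorted-replicate b (suc i))
    (λ {j} j< → ≤-trans (s≤s hf) (≤-reflexive (sym (at-replicate-< b (subst (j <_) (length-replicate b) j<))))) strip
    (super-tab (suc i) (partition-tail P) (at-replicate b)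
      (vanishes-⊞ {v = v} z (n≤1+n i) (≤-reflexive ∘ ∈-replicate b)) (strip-decreasing {v = v} strip) hp′ low′ high′)
  where
  v = replicate b (suc i)

  strip : Strip p v
  strip k with suc k ≟ i
  ... | yes refl rewrite z {suc k} ≤-refl | count-replicate-self (suc (suc k)) b = hp ≤-refl
  ... | no  k≢i rewrite count-replicate-other {suc (suc k)} {suc i} b (λ e → k≢i (sym (suc-injective e)))
                      | +-identityʳ (p (suc k)) = dp k

  hp′ : ∀ {k} → k < suc i → at bs 0 ≤ (p ⊞ v) k
  hp′ {k} (s≤s k≤i) with m≤n⇒m<n∨m≡n k≤i
  ... | inj₁ k<i  = ≤-trans (partition-head≥ P) (≤-trans (hp k<i) (m≤m+n _ _))
  ... | inj₂ refl rewrite count-replicate-self (suc k) b = ≤-trans (partition-head≥ P) (m≤n+m b (p k))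

  low′ : ∀ {k} → k < suc i → q k ≡ (p ⊞ v) k
  low′ {k} (s≤s k≤i) with m≤n⇒m<n∨m≡n k≤i
  ... | inj₁ k<i rewrite count-replicate-other {suc k} {suc i} b (λ e → <-irrefl (suc-injective (sym e)) k<i) =
    trans (low k<i) (sym (+-identityʳ _))
  ... | inj₂ refl rewrite count-replicate-self (suc k) b | z {k} ≤-refl =
    trans (cong q (sym (+-identityʳ k))) (high 0)

  high′ : ∀ k → q (suc i + k) ≡ at bs k
  high′ k = trans (cong q (sym (+-suc i k))) (high (suc k))

LR-super : ∀ {β} → IsPartition β → LR [] β β (super 0 β)
LR-super P = super-tab 0 P z≤n (λ _ → refl) (λ _ → z≤n) (λ ()) (λ ()) (λ _ → refl)

at-injective : ∀ {xs ys} → IsPartition xs → IsPartition ys → at xs ≗ at ys → xs ≡ ys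
at-injective {[]}     {[]}     P Q e = refl
at-injective {[]}     {_ ∷ _}  P Q e = contradiction (subst (1 ≤_) (sym (e 0)) (partition-head>0 Q)) λ ()
at-injective {_ ∷ _}  {[]}     P Q e = contradiction (subst (1 ≤_) (e 0) (partition-head>0 P)) λ ()
at-injective {_ ∷ _}  {_ ∷ _}  P Q e =
  cong₂ _∷_ (e 0) (at-injective (partition-tail P) (partition-tail Q) (e ∘ suc))

LR-[]ˡ : ∀ {β ν T} → IsPartition β → IsPartition ν → LR [] β ν T → T ≡ super 0 β × ν ≡ β
LR-[]ˡ P Q t with T≡ , _ , high ← tab-super 0 P (λ _ → z≤n) (λ _ → refl) t = T≡ , at-injective Q P high

LR-[]ʳ : ∀ {α ν T} → IsPartition α → IsPartition ν → LR α [] ν T → T ≡ [] × ν ≡ α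
LR-[]ʳ P Q ([] e) = refl , at-injective Q P (sym ∘ e)

-- The partitions that attain the bound

-- Adds a first column of height n; partitions with more than n rows are truncated.
fatten : ℕ → List ℕ → List ℕ
fatten zero    _        = []
fatten (suc n) []       = 1 ∷ fatten n []
fatten (suc n) (x ∷ xs) = suc x ∷ fatten n xs

length-fatten : ∀ n xs → length (fatten n xs) ≡ n
length-fatten zero    _        = refl
length-fatten (suc n) []       = cong suc (length-fatten n [])
length-fatten (suc n) (x ∷ xs) = cong suc (length-fatten n xs)

fatten-head : ∀ n xs → at (fatten n xs) 0 ≤ suc (at xs 0)
fatten-head zero    _        = z≤n
fatten-head (suc n) []       = ≤-refl
fatten-head (suc n) (x ∷ xs) = ≤-refl

fatten-partition : ∀ n {xs} → IsPartition xs → IsPartition (fatten n xs)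
fatten-partition zero             P = nil
fatten-partition (suc n) {[]}     P = partition-∷ ≤-refl (fatten-head n []) (fatten-partition n P)
fatten-partition (suc n) {x ∷ xs} P =
  partition-∷ (s≤s z≤n) (≤-trans (fatten-head n xs) (s≤s (partition-head≥ P))) (fatten-partition n (partition-tail P))

peel-fatten : ∀ n {xs} → IsPartition xs → length xs ≤ n → peel (fatten n xs) ≡ xs
peel-fatten zero    {[]}         P _       = refl
peel-fatten (suc n) {[]}         P _       = refl
peel-fatten (suc n) {zero ∷ xs}  P _       = contradiction (partition-head>0 P) λ ()
peel-fatten (suc n) {suc x ∷ xs} P (s≤s h) = cong (suc x ∷_) (peel-fatten n (partition-tail P) h)

fatten-peel : ∀ {xs} → IsPartition xs → fatten (length xs) (peel xs) ≡ xs
fatten-peel {[]}               P = refl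
fatten-peel {zero ∷ xs}        P = contradiction (partition-head>0 P) λ ()
fatten-peel {suc zero ∷ xs}    P = cong (1 ∷_)
  (trans (cong (fatten (length xs)) (sym (peel-column ≤-refl P))) (fatten-peel (partition-tail P)))
fatten-peel {suc (suc x) ∷ xs} P = cong (suc (suc x) ∷_) (fatten-peel (partition-tail P))

-- The leg length `n` has to be given, since the inner partition does not remember how many rows of
-- length one were removed.
addHook : ℕ → ℕ → List ℕ → List ℕ
addHook z n ν = z ∷ fatten n ν

-- The first argument is fuel; length α is enough.
tops : ℕ → List ℕ → List ℕ → List (List ℕ)
tops _       []       β        = [ β ]
tops _       (x ∷ xs) []       = [ x ∷ xs ]
tops zero    (_ ∷ _)  (_ ∷ _)  = []
tops (suc n) (x ∷ xs) (y ∷ ys) =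
  map (addHook (x + y) (length xs + length ys)) (tops n (peel xs) (peel ys)) ++
  map (addHook (x + pred y) (suc (length xs + length ys))) (tops n (peel xs) (peel ys))

⊕-identityʳ : ∀ xs → xs ⊕ [] ≡ xs
⊕-identityʳ []      = refl
⊕-identityʳ (_ ∷ _) = refl

≤lex-refl : ∀ xs → xs ≤lex xs
≤lex-refl []       = _
≤lex-refl (x ∷ xs) = inj₂ (refl , ≤lex-refl xs)

peel-shorter : ∀ {n} xs → suc (length xs) ≤ suc n → length (peel xs) ≤ n
peel-shorter xs (s≤s h) = ≤-trans (length-peel xs) h

LR-nonempty : ∀ {x xs β T} → IsPartition (x ∷ xs) → ¬ LR (x ∷ xs) β [] T
LR-nonempty P t = contradiction (≤-trans (partition-head>0 P) (tab-increasing t 0)) λ ()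

-- The lexicographic order fits the recursion: a strict inequality of first hooks decides, and
-- equality lets `detach` produce a filling for the partitions without their first hooks.
hl-bound : ∀ n {α β ν T} → length α ≤ n → IsPartition α → IsPartition β → IsPartition ν →
           LR α β ν T → hl ν ≤lex (hl α ⊕ hl β)
hl-bound n {[]} {β} h Pα Pβ Pν t with refl ← proj₂ (LR-[]ˡ Pβ Pν t) = ≤lex-refl (hl β)
hl-bound n {x ∷ xs} {[]} h Pα Pβ Pν t with refl ← proj₂ (LR-[]ʳ Pα Pν t) =
  subst (hl (x ∷ xs) ≤lex_) (sym (⊕-identityʳ _)) (≤lex-refl (hl (x ∷ xs)))
hl-bound n {x ∷ xs} {y ∷ ys} {[]} h Pα Pβ Pν t = contradiction t (LR-nonempty Pα)
hl-bound (suc n) {x ∷ xs} {y ∷ ys} {z ∷ zs} h Pα Pβ Pν t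
  rewrite hl-∷ Pα | hl-∷ Pβ | hl-∷ Pν
  with m≤n⇒m<n∨m≡n (first-hook-bound Pα Pβ Pν t)
... | inj₁ lt = inj₁ lt
... | inj₂ eq with _ , _ , t′ , _ ← detach Pα Pβ Pν t eq =
  inj₂ (eq , hl-bound n (peel-shorter xs h) (peel-partition (partition-tail Pα)) (peel-partition (partition-tail Pβ))
               (peel-partition (partition-tail Pν)) t′)

-- Equal hook sequences make every hook extremal, so `detach` applies to both tableaux at each
-- stage.
tableau-unique : ∀ n {α β ν T U} → length α ≤ n → IsPartition α → IsPartition β → IsPartition ν →
                 hl ν ≡ hl α ⊕ hl β → LR α β ν T → LR α β ν U → T ≡ U
tableau-unique n {[]} h Pα Pβ Pν e t u = trans (proj₁ (LR-[]ˡ Pβ Pν t)) (sym (proj₁ (LR-[]ˡ Pβ Pν u)))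
tableau-unique n {x ∷ xs} {[]} h Pα Pβ Pν e t u = trans (proj₁ (LR-[]ʳ Pα Pν t)) (sym (proj₁ (LR-[]ʳ Pα Pν u)))
tableau-unique n {x ∷ xs} {y ∷ ys} {[]} h Pα Pβ Pν e t u = contradiction t (LR-nonempty Pα)
tableau-unique (suc n) {x ∷ xs} {y ∷ ys} {z ∷ zs} h Pα Pβ Pν e t u
  rewrite hl-∷ Pα | hl-∷ Pβ | hl-∷ Pν
  with detach Pα Pβ Pν t (∷-injectiveˡ e) | detach Pα Pβ Pν u (∷-injectiveˡ e)
... | e₁ , T′ , t′ , refl | e₂ , U′ , u′ , refl
  rewrite tableau-unique n (peel-shorter xs h) (peel-partition (partition-tail Pα)) (peel-partition (partition-tail Pβ))
            (peel-partition (partition-tail Pν)) (∷-injectiveʳ e) t′ u′ = attach-irrelevant Pα Pβ Pν e₁ e₂ U′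

tops-complete : ∀ n {α β ν T} → length α ≤ n → IsPartition α → IsPartition β → IsPartition ν →
                hl ν ≡ hl α ⊕ hl β → LR α β ν T → ν ∈ tops n α β
tops-complete n {[]} h Pα Pβ Pν e t = here (proj₂ (LR-[]ˡ Pβ Pν t))
tops-complete n {x ∷ xs} {[]} h Pα Pβ Pν e t = here (proj₂ (LR-[]ʳ Pα Pν t))
tops-complete n {x ∷ xs} {y ∷ ys} {[]} h Pα Pβ Pν e t = contradiction t (LR-nonempty Pα)
tops-complete (suc n) {x ∷ xs} {y ∷ ys} {z ∷ zs} h Pα Pβ Pν e t
  rewrite hl-∷ Pα | hl-∷ Pβ | hl-∷ Pν
  with detach Pα Pβ Pν t (∷-injectiveˡ e)
... | ext , _ , t′ , _ = place ext
  where
  rec : peel zs ∈ tops n (peel xs) (peel ys)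
  rec = tops-complete n (peel-shorter xs h) (peel-partition (partition-tail Pα)) (peel-partition (partition-tail Pβ))
          (peel-partition (partition-tail Pν)) (∷-injectiveʳ e) t′

  ν≡ : ∀ {a b} → z ≡ a → length zs ≡ b → addHook a b (peel zs) ≡ z ∷ zs
  ν≡ refl refl = cong (z ∷_) (fatten-peel (partition-tail Pν))

  place : Extremal Pα Pβ Pν → z ∷ zs ∈ tops (suc n) (x ∷ xs) (y ∷ ys)
  place (is-wide a b) = subst (_∈ tops (suc n) (x ∷ xs) (y ∷ ys)) (ν≡ a b) (∈-++⁺ˡ (∈-map⁺ (addHook _ _) rec))
  place (is-tall a b) = subst (_∈ tops (suc n) (x ∷ xs) (y ∷ ys)) (ν≡ a b)
    (∈-++⁺ʳ (map (addHook (x + y) _) (tops n (peel xs) (peel ys))) (∈-map⁺ (addHook _ _) rec))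

-- Together with `LR-head` this allows a hook to be put around ν: the leg is long enough for
-- `fatten` not to truncate, the arm long enough to give a partition.
LR-length : ∀ {α β ν T} → IsPartition ν → LR α β ν T → length ν ≤ length α + length β
LR-length {α} {β} {ν} Pν t with length ν ≤? length α + length β
... | yes h = h
... | no  h = contradiction (subst (1 ≤_) (tab-vanishes (at-beyond α) t ≤-refl) (at-positive Pν (≰⇒> h))) λ ()

LR-head : ∀ {α β ν T} → IsPartition β → LR α β ν T → at ν 0 ≤ at α 0 + at β 0
LR-head Pβ ([] e) = ≤-trans (≤-reflexive (sym (e 0))) (m≤m+n _ _)
LR-head {α} Pβ (row {v = v} refl so ab st t) = ≤-trans (≤-reflexive (sym (tab-q0 (partition-tail Pβ)
    (λ j< → above-letters (λ _ → z≤n) ab (at-∈ v (<-≤-trans j< (partition-head≥ Pβ)))) t)))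
  (+-monoʳ-≤ (at α 0) (count≤length 1 v))

record Top (α β ν : List ℕ) : Set where
  field
    partition : IsPartition ν
    hooks     : hl ν ≡ hl α ⊕ hl β
    filling   : ∃ (LR α β ν)
open Top

module _ {x xs y ys} (Pα : IsPartition (x ∷ xs)) (Pβ : IsPartition (y ∷ ys)) where
  private
    m = length xs + length ys

    -- The `suc` accounts for the column that `fatten` adds. It is absorbed by `x`, which exceeds
    -- the first part of `peel xs`.
    head-bound : ∀ {ν} → Top (peel xs) (peel ys) ν → suc (at ν 0) ≤ x + pred y
    head-bound {ν} t = ≤-trans (s≤s (LR-head {peel xs} {ν = ν} (peel-partition (partition-tail Pβ)) (proj₂ (filling t))))
      (subst₂ (λ a b → suc (a + b) ≤ x + pred y) (sym (at-peel (partition-tail Pα) 0)) (sym (at-peel (partition-tail Pβ) 0))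
        (+-mono-≤ (suc-pred≤ (partition-head>0 Pα) (partition-head≥ Pα)) (pred-mono-≤ (partition-head≥ Pβ))))
      where
      suc-pred≤ : ∀ {a b} → 1 ≤ b → a ≤ b → suc (pred a) ≤ b
      suc-pred≤ {zero}  1≤b _ = 1≤b
      suc-pred≤ {suc a} _   h = h

  top-length : ∀ {ν} → Top (peel xs) (peel ys) ν → length ν ≤ m
  top-length t = ≤-trans (LR-length {peel xs} (partition t) (proj₂ (filling t))) (+-mono-≤ (length-peel xs) (length-peel ys))

  module _ {ν z n} (t : Top (peel xs) (peel ys) ν) (z≥ : suc (at ν 0) ≤ z) (m≤n : m ≤ n) where
    private
      peel≡ : peel (fatten n ν) ≡ ν
      peel≡ = peel-fatten n (partition t) (≤-trans (top-length t) m≤n)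

      P : IsPartition (addHook z n ν)
      P = partition-∷ (≤-trans (s≤s z≤n) z≥) (≤-trans (fatten-head n ν) z≥) (fatten-partition n (partition t))

    extend-top : Extremal Pα Pβ P → Top (x ∷ xs) (y ∷ ys) (addHook z n ν)
    extend-top e = record
      { partition = P
      ; hooks     = trans (hl-∷ P) (trans (cong₂ _∷_ (extremal-hook Pα Pβ P e) (trans (cong hl peel≡) (hooks t)))
                      (sym (cong₂ _⊕_ (hl-∷ Pα) (hl-∷ Pβ))))
      ; filling   = _ , attach-LR Pα Pβ P e (subst (λ κ → LR (peel xs) (peel ys) κ (proj₁ (filling t))) (sym peel≡) (proj₂ (filling t)))
      }

  extend-wide : ∀ {ν} → Top (peel xs) (peel ys) ν → Top (x ∷ xs) (y ∷ ys) (addHook (x + y) m ν)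
  extend-wide {ν} t = extend-top t (≤-trans (head-bound t) (+-monoʳ-≤ x pred[n]≤n)) ≤-refl (is-wide refl (length-fatten m ν))

  extend-tall : ∀ {ν} → Top (peel xs) (peel ys) ν → Top (x ∷ xs) (y ∷ ys) (addHook (x + pred y) (suc m) ν)
  extend-tall {ν} t = extend-top t (head-bound t) (n≤1+n m) (is-tall refl (length-fatten (suc m) ν))

tops-sound : ∀ n {α β ν} → IsPartition α → IsPartition β → ν ∈ tops n α β → Top α β ν
tops-sound n {[]} Pα Pβ (here refl) = record { partition = Pβ ; hooks = refl ; filling = _ , LR-super Pβ }
tops-sound n {x ∷ xs} {[]} Pα Pβ (here refl) =
  record { partition = Pα ; hooks = sym (⊕-identityʳ _) ; filling = [] , [] (λ _ → refl) }
tops-sound (suc n) {x ∷ xs} {y ∷ ys} Pα Pβ ν∈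
  with ∈-++⁻ (map (addHook (x + y) (length xs + length ys)) (tops n (peel xs) (peel ys))) ν∈
... | inj₁ ν∈′ with _ , κ∈ , refl ← ∈-map⁻ _ ν∈′ =
  extend-wide Pα Pβ (tops-sound n (peel-partition (partition-tail Pα)) (peel-partition (partition-tail Pβ)) κ∈)
... | inj₂ ν∈′ with _ , κ∈ , refl ← ∈-map⁻ _ ν∈′ =
  extend-tall Pα Pβ (tops-sound n (peel-partition (partition-tail Pα)) (peel-partition (partition-tail Pβ)) κ∈)

-- The left inverse is required on members only, because `addHook` truncates lists that are too
-- long.
unique-map : ∀ {A B : Set} {f : A → B} (g : B → A) {xs} → (∀ {x} → x ∈ xs → g (f x) ≡ x) → Unique xs → Unique (map f xs)
unique-map {f = f} g {xs} h u = Unique.map⁻ {f = g}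
  (subst Unique (trans (sym (map-id-local (All.tabulate h))) (map-∘ xs)) u)

-- Within each half the inner partition is recovered by `peel`, and the two halves differ in the
-- number of rows.
tops-unique : ∀ n {α β} → IsPartition α → IsPartition β → Unique (tops n α β)
tops-unique n {[]} Pα Pβ = [] ∷ []
tops-unique n {x ∷ xs} {[]} Pα Pβ = [] ∷ []
tops-unique zero {x ∷ xs} {y ∷ ys} Pα Pβ = []
tops-unique (suc n) {x ∷ xs} {y ∷ ys} Pα Pβ =
  Unique.++⁺ (unique-map tail-peel (undo {x + y} ≤-refl) rec) (unique-map tail-peel (undo {x + pred y} (n≤1+n _)) rec) disjoint
  where
  rec = tops-unique n (peel-partition (partition-tail Pα)) (peel-partition (partition-tail Pβ))
  m = length xs + length ys

  tail-peel : List ℕ → List ℕ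
  tail-peel []       = []
  tail-peel (_ ∷ zs) = peel zs

  undo : ∀ {z k} → m ≤ k → ∀ {κ} → κ ∈ tops n (peel xs) (peel ys) → tail-peel (addHook z k κ) ≡ κ
  undo {k = k} h κ∈ with t ← tops-sound n (peel-partition (partition-tail Pα)) (peel-partition (partition-tail Pβ)) κ∈ =
    peel-fatten k (partition t) (≤-trans (top-length Pα Pβ t) h)

  disjoint : ∀ {ν} → ¬ (ν ∈ map (addHook (x + y) m) (tops n (peel xs) (peel ys)) ×
                        ν ∈ map (addHook (x + pred y) (suc m)) (tops n (peel xs) (peel ys)))
  disjoint (a , b) with ∈-map⁻ _ a | ∈-map⁻ _ b
  ... | κ , _ , refl | κ′ , _ , e =
    contradiction (trans (sym (length-fatten m κ)) (trans (cong length (∷-injectiveʳ e)) (length-fatten (suc m) κ′))) (<⇒≢ ≤-refl)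

length-tops : ∀ n {α β} → length α ≤ n → IsPartition α → IsPartition β →
              length (tops n α β) ≡ 2 ^ (durfee α ⊓ durfee β)
length-tops n {[]} h Pα Pβ = refl
length-tops n {x ∷ xs} {[]} h Pα Pβ rewrite ⊓-zeroʳ (durfee (x ∷ xs)) = refl
length-tops (suc n) {x ∷ xs} {y ∷ ys} h Pα Pβ
  rewrite durfee-∷ Pα | durfee-∷ Pβ
        | length-++ (map (addHook (x + y) (length xs + length ys)) (tops n (peel xs) (peel ys)))
            {map (addHook (x + pred y) (suc (length xs + length ys))) (tops n (peel xs) (peel ys))}
        | length-map (addHook (x + y) (length xs + length ys)) (tops n (peel xs) (peel ys))
        | length-map (addHook (x + pred y) (suc (length xs + length ys))) (tops n (peel xs) (peel ys))
        | length-tops n (peel-shorter xs h) (peel-partition (partition-tail Pα)) (peel-partition (partition-tail Pβ))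
        | +-identityʳ (2 ^ (durfee (peel xs) ⊓ durfee (peel ys))) = refl

-- Northwest ribbons

T-ext : ∀ {a b} → (T a → T b) → (T b → T a) → a ≡ b
T-ext {true}  {true}  f g = refl
T-ext {false} {false} f g = refl
T-ext {true}  {false} f g = contradiction (f _) λ ()
T-ext {false} {true}  f g = contradiction (g _) λ ()

filterᵇ-cong : ∀ {A : Set} {p q : A → Bool} xs → (∀ {x} → x ∈ xs → p x ≡ q x) → filterᵇ p xs ≡ filterᵇ q xs
filterᵇ-cong []       h = refl
filterᵇ-cong {p = p} {q} (x ∷ xs) h with p x | q x | h (here refl) | filterᵇ-cong {p = p} {q} xs (h ∘ there)
... | true  | _ | refl | e = cong (x ∷_) e
... | false | _ | refl | e = e

memB⇒∈ : ∀ {x} A → T (memB x A) → x ∈ A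
memB⇒∈ {i , j} A h = Any.map (λ { {k , l} e → let e₁ , e₂ = to (T-∧ {i ≡ᵇ k}) e in
  cong₂ _,_ (≡ᵇ⇒≡ i k e₁) (≡ᵇ⇒≡ j l e₂) }) (Any.any⁻ _ A h)

∈⇒memB : ∀ {x A} → x ∈ A → T (memB x A)
∈⇒memB {i , j} x∈ = Any.any⁺ _ (Any.map (λ { refl → from (T-∧ {i ≡ᵇ i}) (≡⇒≡ᵇ i i refl , ≡⇒≡ᵇ j j refl) }) x∈)

northwest : Box → Box
northwest (i , j) = (i ∸ 1 , j ∸ 1)

interior : List Box → Box → Bool
interior A x = memB (northwest x) A

nw1-filter : ∀ A → nw1 A ≡ filterᵇ (not ∘ interior A) A
nw1-filter A = filterᵇ-cong A λ { {i , j} _ → refl }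

removeB-filter : ∀ (p : Box → Bool) A → removeB (filterᵇ p A) A ≡ filterᵇ (not ∘ p) A
removeB-filter p A = filterᵇ-cong A λ {x} x∈ → cong not (T-ext
  (λ h → proj₂ (∈-filter⁻ (T? ∘ p) {xs = A} (memB⇒∈ (filterᵇ p A) h)))
  (λ h → ∈⇒memB (∈-filter⁺ (T? ∘ p) x∈ h)))

rowBoxes : ℕ → ℕ → ℕ → List Box
rowBoxes i b x = map (λ t → (i , b + suc t)) (upTo x)

-- The diagram of α with its corner box moved from (1, 1) to (suc a, suc b).
boxes : ℕ → ℕ → List ℕ → List Box
boxes a b []       = []
boxes a b (x ∷ xs) = rowBoxes (suc a) b x ++ boxes (suc a) b xs

∈-boxes⁻ : ∀ {a b} xs {c} → c ∈ boxes a b xs → ∃ λ i → ∃ λ s → c ≡ (suc (a + i) , b + suc s) × s < at xs i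
∈-boxes⁻ {a} {b} (x ∷ xs) c∈ with ∈-++⁻ (rowBoxes (suc a) b x) c∈
... | inj₁ c∈′ with s , s∈ , refl ← ∈-map⁻ _ c∈′ = 0 , s , cong (λ k → suc k , b + suc s) (sym (+-identityʳ a)) , ∈-upTo⁻ s∈
... | inj₂ c∈′ with i , s , refl , s< ← ∈-boxes⁻ xs c∈′ = suc i , s , cong (λ k → suc k , b + suc s) (sym (+-suc a i)) , s<

∈-boxes⁺ : ∀ {a b} xs i {s} → s < at xs i → (suc (a + i) , b + suc s) ∈ boxes a b xs
∈-boxes⁺ {a} {b} (x ∷ xs) zero {s} s< = ∈-++⁺ˡ
  (subst (λ k → (suc k , b + suc s) ∈ rowBoxes (suc a) b x) (sym (+-identityʳ a)) (∈-map⁺ _ (∈-upTo⁺ s<)))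
∈-boxes⁺ {a} {b} (x ∷ xs) (suc i) {s} s< = ∈-++⁺ʳ (rowBoxes (suc a) b x)
  (subst (λ k → (suc k , b + suc s) ∈ boxes (suc a) b xs) (sym (+-suc a i)) (∈-boxes⁺ xs i s<))

onEdge : ℕ → ℕ → Box → Bool
onEdge a b (i , j) = (i ≡ᵇ suc a) ∨ (j ≡ᵇ suc b)

onEdge⇒ : ∀ a b i s → T (onEdge a b (suc (a + i) , b + suc s)) → i ≡ 0 ⊎ s ≡ 0
onEdge⇒ a b i s h with to (T-∨ {suc (a + i) ≡ᵇ suc a}) h
... | inj₁ e = inj₁ (+-cancelˡ-≡ a i 0 (trans (≡ᵇ⇒≡ (a + i) a e) (sym (+-identityʳ a))))
... | inj₂ e = inj₂ (suc-injective (+-cancelˡ-≡ b (suc s) 1 (trans (≡ᵇ⇒≡ (b + suc s) (suc b) e) (+-comm 1 b))))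

onEdge⇐ : ∀ a b i s → i ≡ 0 ⊎ s ≡ 0 → T (onEdge a b (suc (a + i) , b + suc s))
onEdge⇐ a b i s (inj₁ refl) = from (T-∨ {a + 0 ≡ᵇ a}) (inj₁ (≡⇒≡ᵇ (a + 0) a (+-identityʳ a)))
onEdge⇐ a b i s (inj₂ refl) = from (T-∨ {suc (a + i) ≡ᵇ suc a}) (inj₂ (≡⇒≡ᵇ (b + 1) (suc b) (+-comm b 1)))

-- For a box of a piece of the diagram A, the box to its northwest lies in A exactly
-- if it lies in that piece, which fails exactly on the first row and column.
edge-interior : ∀ {a b α A} → IsPartition α →
                (∀ {x} → x ∈ boxes a b α → x ∈ A) →
                (∀ {x} → x ∈ boxes a b α → northwest x ∈ A → northwest x ∈ boxes a b α) →
                ∀ {x} → x ∈ boxes a b α → not (interior A x) ≡ onEdge a b x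
edge-interior {a} {b} {α} {A} P sub cl {x} x∈ = T-ext fwd bwd
  where
  fwd : T (not (interior A x)) → T (onEdge a b x)
  fwd h with ∈-boxes⁻ α x∈
  ... | zero  , s     , refl , s< = onEdge⇐ a b 0 s (inj₁ refl)
  ... | suc i , zero  , refl , s< = onEdge⇐ a b (suc i) 0 (inj₂ refl)
  ... | suc i , suc s , refl , s< = contradiction (∈⇒memB (sub nw∈α)) (subst (λ c → ¬ T c) (sym (to T-not-≡ h)) λ ())
    where
    nw∈α : northwest (suc (a + suc i) , b + suc (suc s)) ∈ boxes a b α
    nw∈α rewrite +-suc a i | +-suc b (suc s) = ∈-boxes⁺ α i (<-≤-trans (<⇒≤ s<) (at-decreasing P i))

  bwd : T (onEdge a b x) → T (not (interior A x))
  bwd h with interior A x in eq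
  ... | false = _
  ... | true with ∈-boxes⁻ α x∈ | cl x∈ (memB⇒∈ A (from T-≡ eq))
  -- The northwest neighbour of an edge box lies in row `a` or column `b`, whereas the piece starts
  -- at row `suc a` and column `suc b`.
  ...   | i , s , refl , _ | nw∈ with ∈-boxes⁻ α nw∈ | onEdge⇒ a b i s h
  ...     | i′ , s′ , e , _ | inj₁ refl = contradiction (trans (sym (+-identityʳ a)) (cong proj₁ e)) (<⇒≢ (s≤s (m≤m+n a i′)))
  ...     | i′ , s′ , e , _ | inj₂ refl =
    contradiction (trans (trans (sym (+-identityʳ b)) (sym (cong (_∸ 1) (+-suc b 0)))) (cong proj₂ e)) (<⇒≢ (subst (b <_) (sym (+-suc b s′)) (s≤s (m≤m+n b s′))))

filterᵇ-all : ∀ {A : Set} {p : A → Bool} xs → (∀ {x} → x ∈ xs → T (p x)) → filterᵇ p xs ≡ xs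
filterᵇ-all {p = p} xs h = filter-all (T? ∘ p) (All.tabulate h)

filterᵇ-none : ∀ {A : Set} {p : A → Bool} xs → (∀ {x} → x ∈ xs → ¬ T (p x)) → filterᵇ p xs ≡ []
filterᵇ-none {p = p} xs h = filter-none (T? ∘ p) (All.tabulate h)

T-not⁻ : ∀ {b} → T (not b) → ¬ T b
T-not⁻ {false} _ ()

T-not⁺ : ∀ {b} → ¬ T b → T (not b)
T-not⁺ {false} _ = _
T-not⁺ {true}  h = h _

rowBoxes-suc : ∀ i b x → rowBoxes i b (suc x) ≡ (i , b + 1) ∷ rowBoxes i (suc b) x
rowBoxes-suc i b x = cong ((i , b + 1) ∷_) (begin
  map (λ t → (i , b + suc t)) (applyUpTo suc x)       ≡⟨ cong (map _) (sym (map-applyUpTo id suc x)) ⟩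
  map (λ t → (i , b + suc t)) (map suc (upTo x))      ≡⟨ map-∘ (upTo x) ⟨
  map (λ t → (i , b + suc (suc t))) (upTo x)          ≡⟨ map-cong (λ t → cong (i ,_) (+-suc b (suc t))) (upTo x) ⟩
  rowBoxes i (suc b) x                                ∎)
  where open ≡-Reasoning

first-row-edge : ∀ a b x {c} → c ∈ rowBoxes (suc a) b x → T (onEdge a b c)
first-row-edge a b x c∈ with s , _ , refl ← ∈-map⁻ _ c∈ =
  from (T-∨ {a ≡ᵇ a}) (inj₁ (≡⇒≡ᵇ a a refl))

module _ {a b : ℕ} where
  private
    shifted-inner : ∀ {i} x {c} → suc a < i → c ∈ rowBoxes i (suc b) x → ¬ T (onEdge a b c)
    shifted-inner {i} x a<i c∈ h with s , _ , refl ← ∈-map⁻ _ c∈ with to (T-∨ {i ≡ᵇ suc a}) h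
    ... | inj₁ e = <⇒≢ a<i (sym (≡ᵇ⇒≡ i (suc a) e))
    ... | inj₂ e = <⇒≢ (subst (suc b <_) (sym (+-suc (suc b) s)) (s≤s (m≤m+n (suc b) s))) (sym (≡ᵇ⇒≡ (suc b + suc s) (suc b) e))

    head-edge : ∀ i → T (onEdge a b (i , b + 1))
    head-edge i = from (T-∨ {i ≡ᵇ suc a}) (inj₂ (≡⇒≡ᵇ (b + 1) (suc b) (+-comm b 1)))

  row-edge : ∀ {i} x → suc a < i → 1 ≤ x → length (filterᵇ (onEdge a b) (rowBoxes i b x)) ≡ 1
  row-edge {i} (suc x) a<i _ = trans (cong (length ∘ filterᵇ (onEdge a b)) (rowBoxes-suc i b x))
    (trans (cong length (filter-accept (T? ∘ onEdge a b) {i , b + 1} {rowBoxes i (suc b) x} (head-edge i)))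
      (cong (suc ∘ length) (filterᵇ-none (rowBoxes i (suc b) x) (shifted-inner x a<i))))

  row-inner : ∀ {i} x → suc a < i → filterᵇ (not ∘ onEdge a b) (rowBoxes i b x) ≡ rowBoxes i (suc b) (pred x)
  row-inner zero        a<i = refl
  row-inner {i} (suc x) a<i = trans (cong (filterᵇ (not ∘ onEdge a b)) (rowBoxes-suc i b x))
    (trans (filter-reject (T? ∘ not ∘ onEdge a b) {i , b + 1} {rowBoxes i (suc b) x} (λ h → T-not⁻ h (head-edge i)))
      (filterᵇ-all (rowBoxes i (suc b) x) (λ c∈ → T-not⁺ (shifted-inner x a<i c∈))))

  -- Below the first row only first-column boxes are on the edge, one in each row.
  lower-edge : ∀ {a′} xs → a < a′ → IsPartition xs → length (filterᵇ (onEdge a b) (boxes a′ b xs)) ≡ length xs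
  lower-edge []       h P = refl
  lower-edge {a′} (x ∷ xs) h P = begin
    length (filterᵇ (onEdge a b) (rowBoxes (suc a′) b x ++ boxes (suc a′) b xs))
      ≡⟨ cong length (filter-++ _ (rowBoxes (suc a′) b x) _) ⟩
    length (filterᵇ (onEdge a b) (rowBoxes (suc a′) b x) ++ filterᵇ (onEdge a b) (boxes (suc a′) b xs))
      ≡⟨ length-++ (filterᵇ (onEdge a b) (rowBoxes (suc a′) b x)) ⟩
    length (filterᵇ (onEdge a b) (rowBoxes (suc a′) b x)) + length (filterᵇ (onEdge a b) (boxes (suc a′) b xs))
      ≡⟨ cong₂ _+_ (row-edge x (s≤s h) (partition-head>0 P)) (lower-edge xs (m<n⇒m<1+n h) (partition-tail P)) ⟩
    suc (length xs) ∎
    where open ≡-Reasoning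

  lower-inner : ∀ {a′} xs → a < a′ → IsPartition xs →
                filterᵇ (not ∘ onEdge a b) (boxes a′ b xs) ≡ boxes a′ (suc b) (peel xs)
  lower-inner []       h P = refl
  lower-inner {a′} (x ∷ xs) h P = trans (filter-++ _ (rowBoxes (suc a′) b x) _)
    (trans (cong₂ _++_ (row-inner x (s≤s h)) (lower-inner xs (m<n⇒m<1+n h) (partition-tail P))) (last-step x P))
    where
    last-step : ∀ x → IsPartition (x ∷ xs) →
                rowBoxes (suc a′) (suc b) (pred x) ++ boxes (suc a′) (suc b) (peel xs) ≡ boxes a′ (suc b) (peel (x ∷ xs))
    last-step zero          P = contradiction (partition-head>0 P) λ ()
    last-step (suc zero)    P = cong (boxes (suc a′) (suc b)) (peel-column ≤-refl P)
    last-step (suc (suc x)) P = refl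

firstHook : List ℕ → ℕ
firstHook []       = 0
firstHook (x ∷ xs) = x + length xs

afterHook : List ℕ → List ℕ
afterHook []       = []
afterHook (x ∷ xs) = peel xs

edge-boxes : ∀ a b {α} → IsPartition α → length (filterᵇ (onEdge a b) (boxes a b α)) ≡ firstHook α
edge-boxes a b {[]}     P = refl
edge-boxes a b {x ∷ xs} P = begin
  length (filterᵇ (onEdge a b) (rowBoxes (suc a) b x ++ boxes (suc a) b xs))
    ≡⟨ cong length (filter-++ _ (rowBoxes (suc a) b x) _) ⟩
  length (filterᵇ (onEdge a b) (rowBoxes (suc a) b x) ++ filterᵇ (onEdge a b) (boxes (suc a) b xs))
    ≡⟨ length-++ (filterᵇ (onEdge a b) (rowBoxes (suc a) b x)) ⟩
  length (filterᵇ (onEdge a b) (rowBoxes (suc a) b x)) + length (filterᵇ (onEdge a b) (boxes (suc a) b xs))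
    ≡⟨ cong₂ _+_ (cong length (filterᵇ-all (rowBoxes (suc a) b x) (first-row-edge a b x))) (lower-edge xs ≤-refl (partition-tail P)) ⟩
  length (rowBoxes (suc a) b x) + length xs
    ≡⟨ cong (_+ length xs) (trans (length-map _ (upTo x)) (length-upTo x)) ⟩
  x + length xs ∎
  where open ≡-Reasoning

inner-boxes : ∀ a b {α} → IsPartition α →
              filterᵇ (not ∘ onEdge a b) (boxes a b α) ≡ boxes (suc a) (suc b) (afterHook α)
inner-boxes a b {[]}     P = refl
inner-boxes a b {x ∷ xs} P = trans (filter-++ _ (rowBoxes (suc a) b x) _) (cong₂ _++_
  (filterᵇ-none (rowBoxes (suc a) b x) (λ c∈ h → T-not⁻ h (first-row-edge a b x c∈)))
  (lower-inner xs ≤-refl (partition-tail P)))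

afterHook-partition : ∀ {α} → IsPartition α → IsPartition (afterHook α)
afterHook-partition {[]}    P = nil
afterHook-partition {_ ∷ _} P = peel-partition (partition-tail P)

afterHook-length : ∀ α → length (afterHook α) ≤ pred (length α)
afterHook-length []       = z≤n
afterHook-length (x ∷ xs) = length-peel xs

afterHook-head : ∀ {α} → IsPartition α → at (afterHook α) 0 ≤ at α 0
afterHook-head {[]}     P = z≤n
afterHook-head {x ∷ xs} P = subst (_≤ x) (sym (at-peel (partition-tail P) 0)) (≤-trans pred[n]≤n (partition-head≥ P))

module _ {a b c d : ℕ} {α β : List ℕ} (Pα : IsPartition α) (Pβ : IsPartition β)
         (rows : a + length α ≤ c) (cols : d + at β 0 ≤ b) where
  private
    A = boxes a b α ++ boxes c d β

    -- Northwest neighbours cannot change pieces: those of α lie above all rows of β, those of β to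
    -- the left of all columns of α.
    nw-α : ∀ {x} → x ∈ boxes a b α → northwest x ∈ A → northwest x ∈ boxes a b α
    nw-α x∈ nw∈ with ∈-++⁻ (boxes a b α) nw∈
    ... | inj₁ h = h
    ... | inj₂ h with ∈-boxes⁻ α x∈ | ∈-boxes⁻ β h
    ...   | i , s , refl , s< | i′ , s′ , e , _ = contradiction
      (≤-trans (+-monoʳ-< a (at-positive⁻ α (≤-trans (s≤s z≤n) s<))) (≤-trans rows (m≤m+n c i′)))
      (λ lt → <-irrefl (cong proj₁ e) (m<n⇒m<1+n lt))

    nw-β : ∀ {x} → x ∈ boxes c d β → northwest x ∈ A → northwest x ∈ boxes c d β
    nw-β x∈ nw∈ with ∈-++⁻ (boxes a b α) nw∈
    ... | inj₂ h = h
    ... | inj₁ h with ∈-boxes⁻ β x∈ | ∈-boxes⁻ α h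
    ...   | i , s , refl , s< | i′ , s′ , e , _ = contradiction
      (≤-trans (+-monoʳ-< d (<-≤-trans s< (at-antitone Pβ z≤n))) (≤-trans cols (m≤m+n b (suc s′))))
      (<-irrefl (trans (cong (_∸ 1) (sym (+-suc d s))) (cong proj₂ e)))

    split : ∀ (p q r : Box → Bool) → (∀ {x} → x ∈ boxes a b α → p x ≡ q x) → (∀ {x} → x ∈ boxes c d β → p x ≡ r x) →
            filterᵇ p A ≡ filterᵇ q (boxes a b α) ++ filterᵇ r (boxes c d β)
    split p q r e₁ e₂ = trans (filter-++ _ (boxes a b α) _) (cong₂ _++_ (filterᵇ-cong _ e₁) (filterᵇ-cong _ e₂))

    eα : ∀ {x} → x ∈ boxes a b α → not (interior A x) ≡ onEdge a b x
    eα = edge-interior Pα ∈-++⁺ˡ nw-α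

    eβ : ∀ {x} → x ∈ boxes c d β → not (interior A x) ≡ onEdge c d x
    eβ = edge-interior Pβ (∈-++⁺ʳ (boxes a b α)) nw-β

  length-nw1 : length (nw1 A) ≡ firstHook α + firstHook β
  length-nw1 = trans (cong length (trans (nw1-filter A) (split _ _ _ eα eβ)))
    (trans (length-++ (filterᵇ (onEdge a b) (boxes a b α))) (cong₂ _+_ (edge-boxes a b Pα) (edge-boxes c d Pβ)))

  remove-nw1 : removeB (nw1 A) A ≡ boxes (suc a) (suc b) (afterHook α) ++ boxes (suc c) (suc d) (afterHook β)
  remove-nw1 = trans (cong (λ R → removeB R A) (nw1-filter A)) (trans (removeB-filter (not ∘ interior A) A)
    (trans (split _ _ _ (cong not ∘ eα) (cong not ∘ eβ)) (cong₂ _++_ (inner-boxes a b Pα) (inner-boxes c d Pβ))))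

hl-first : ∀ {α β} → IsPartition α → IsPartition β → 1 ≤ length α + length β →
           hl α ⊕ hl β ≡ (firstHook α + firstHook β) ∷ (hl (afterHook α) ⊕ hl (afterHook β))
hl-first {[]}    {y ∷ ys} Pα Pβ _ = hl-∷ Pβ
hl-first {_ ∷ _} {y ∷ ys} Pα Pβ _ = cong₂ _⊕_ (hl-∷ Pα) (hl-∷ Pβ)
hl-first {x ∷ xs} {[]}    Pα Pβ _ = trans (⊕-identityʳ _) (trans (hl-∷ Pα) (cong₂ _∷_ (sym (+-identityʳ _)) (sym (⊕-identityʳ _))))

nwLengths-step : ∀ f A → 1 ≤ length A → nwLengths (suc f) A ≡ length (nw1 A) ∷ nwLengths f (removeB (nw1 A) A)
nwLengths-step f (_ ∷ _) _ = refl

length-boxes : ∀ a b {α} → IsPartition α → length α ≤ length (boxes a b α)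
length-boxes a b {[]}         P = z≤n
length-boxes a b {zero ∷ xs}  P = contradiction (partition-head>0 P) λ ()
length-boxes a b {suc x ∷ xs} P rewrite length-++ (rowBoxes (suc a) b (suc x)) {boxes (suc a) b xs} =
  s≤s (≤-trans (length-boxes (suc a) b (partition-tail P)) (m≤n+m _ _))

-- Deleting the ribbons moves both corners one step along the diagonal and preserves the relative
-- position of the pieces. The number of rows is enough fuel, as each nonempty piece loses at least
-- one row.
nwLengths-boxes-step : ∀ f {a b c d α β} → IsPartition α → IsPartition β → a + length α ≤ c → d + at β 0 ≤ b →
                       1 ≤ length α + length β → length α + length β ≤ suc f →
                       nwLengths (suc f) (boxes a b α ++ boxes c d β) ≡ hl α ⊕ hl β

nwLengths-boxes : ∀ f {a b c d α β} → IsPartition α → IsPartition β → a + length α ≤ c → d + at β 0 ≤ b →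
                  length α + length β ≤ f → nwLengths f (boxes a b α ++ boxes c d β) ≡ hl α ⊕ hl β
nwLengths-boxes zero    {α = []} {[]} Pα Pβ rows cols h = refl
nwLengths-boxes (suc f) {α = []} {[]} Pα Pβ rows cols h = refl
nwLengths-boxes (suc f) {α = []} {_ ∷ _} Pα Pβ rows cols h = nwLengths-boxes-step f Pα Pβ rows cols (s≤s z≤n) h
nwLengths-boxes (suc f) {α = _ ∷ _}      Pα Pβ rows cols h = nwLengths-boxes-step f Pα Pβ rows cols (s≤s z≤n) h

nwLengths-boxes-step f {a} {b} {c} {d} {α} {β} Pα Pβ rows cols pos h = begin
  nwLengths (suc f) A                                     ≡⟨ nwLengths-step f A nonempty ⟩
  length (nw1 A) ∷ nwLengths f (removeB (nw1 A) A)
    ≡⟨ cong₂ (λ k R → k ∷ nwLengths f R) (length-nw1 Pα Pβ rows cols) (remove-nw1 Pα Pβ rows cols) ⟩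
  firstHook α + firstHook β ∷ nwLengths f (boxes (suc a) (suc b) (afterHook α) ++ boxes (suc c) (suc d) (afterHook β))
    ≡⟨ cong (firstHook α + firstHook β ∷_) (nwLengths-boxes f (afterHook-partition Pα) (afterHook-partition Pβ)
         (s≤s (≤-trans (+-monoʳ-≤ a (≤-trans (afterHook-length α) pred[n]≤n)) rows))
         (s≤s (≤-trans (+-monoʳ-≤ d (afterHook-head Pβ)) cols))
         (≤-trans (+-mono-≤ (afterHook-length α) (afterHook-length β)) (pred-sum (length α) (length β) h))) ⟩
  firstHook α + firstHook β ∷ (hl (afterHook α) ⊕ hl (afterHook β))  ≡⟨ hl-first Pα Pβ pos ⟨
  hl α ⊕ hl β                                             ∎
  where
  open ≡-Reasoning
  A = boxes a b α ++ boxes c d β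

  nonempty : 1 ≤ length A
  nonempty = ≤-trans pos (≤-trans (+-mono-≤ (length-boxes a b Pα) (length-boxes c d Pβ))
    (≤-reflexive (sym (length-++ (boxes a b α)))))

  pred-sum : ∀ m n → m + n ≤ suc f → pred m + pred n ≤ f
  pred-sum zero    n h       = pred-mono-≤ h
  pred-sum (suc m) n (s≤s h) = ≤-trans (+-monoʳ-≤ m pred[n]≤n) h

-- Lattice words, row by row

-- The lattice part of `Tab` without shape or columns. It also applies to a filling of the whole
-- diagram, including the empty rows around the pieces.
data Chain (q : ℕ → ℕ) : (ℕ → ℕ) → List (List ℕ) → Set where
  []  : ∀ {p} → p ≗ q → Chain q p []
  _∷_ : ∀ {p v vs} → Strip p v → Chain q (p ⊞ v) vs → Chain q p (v ∷ vs)

chain-cong : ∀ {q p p′ t} → p ≗ p′ → Chain q p t → Chain q p′ t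
chain-cong e ([] h) = [] λ k → trans (sym (e k)) (h k)
chain-cong e (_∷_ {v = v} s c) = strip-cong {v = v} e s ∷ chain-cong (λ k → cong (_+ count (suc k) v) (e k)) c

chain-++⁻ : ∀ {q p} t {u} → Chain q p (t ++ u) → ∃ λ r → Chain r p t × Chain q r u
chain-++⁻ []      c       = _ , [] (λ _ → refl) , c
chain-++⁻ (v ∷ t) (s ∷ c) with r , c₁ , c₂ ← chain-++⁻ t c = r , s ∷ c₁ , c₂

chain-++⁺ : ∀ {q r p t u} → Chain r p t → Chain q r u → Chain q p (t ++ u)
chain-++⁺ ([] e)  c = chain-cong (sym ∘ e) c
chain-++⁺ (s ∷ d) c = s ∷ chain-++⁺ d c

chain-empty⁻ : ∀ {q p} n → Chain q p (replicate n []) → p ≗ q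
chain-empty⁻ zero    ([] e)  k = e k
chain-empty⁻ (suc n) (_ ∷ c) k = trans (sym (+-identityʳ _)) (chain-empty⁻ n c k)

-- Even an empty row carries a strip condition, namely that the content decreases at that point.
chain-empty⁺ : ∀ {q p} n → (∀ k → q (suc k) ≤ q k) → p ≗ q → Chain q p (replicate n [])
chain-empty⁺ zero    d e = [] e
chain-empty⁺ (suc n) d e =
  (λ k → subst₂ _≤_ (sym (trans (+-identityʳ _) (e (suc k)))) (sym (e k)) (d k)) ∷
  chain-empty⁺ n d (λ k → trans (+-identityʳ _) (e k))

chain-content : ∀ {q p t} → Chain q p t → ∀ k → p k + count (suc k) (concat t) ≡ q k
chain-content ([] e) k = trans (+-identityʳ _) (e k)
chain-content {p = p} (_∷_ {v = v} {vs} s c) k = trans (cong (p k +_) (count-++ (suc k) v (concat vs)))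
  (trans (sym (+-assoc (p k) _ _)) (chain-content c k))

Lattice : (ℕ → ℕ) → List ℕ → Set
Lattice p w = ∀ u u′ → u ++ u′ ≡ w → ∀ k → p (suc k) + count (suc (suc k)) u ≤ p k + count (suc k) u

sorted-split : ∀ {v} n → Sorted v → ∃ λ lo → ∃ λ hi →
               v ≡ lo ++ hi × (∀ {x} → x ∈ lo → x ≤ n) × (∀ {x} → x ∈ hi → n < x)
sorted-split {[]} n s = [] , [] , refl , (λ ()) , λ ()
sorted-split {x ∷ v} n (h ∷ s) with x ≤? n
... | no  x≰n = [] , x ∷ v , refl , (λ ()) ,
  λ { (here refl) → ≰⇒> x≰n ; (there y∈) → <-≤-trans (≰⇒> x≰n) (All.lookup h y∈) }
... | yes x≤n with lo , hi , refl , l , g ← sorted-split n s =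
  x ∷ lo , hi , refl , (λ { (here refl) → x≤n ; (there y∈) → l y∈ }) , g

reading : List (List ℕ) → List ℕ
reading = concatMap reverse

-- Reading the row from the right, stop after the letters larger than `suc k`: all letters
-- `suc (suc k)` have been read and no `suc k` yet. The prefix condition at this point is the strip
-- inequality.
lattice-strip : ∀ {p v w} → Sorted v → Lattice p (reverse v ++ w) → Strip p v
lattice-strip {p} {w = w} so L k with lo , hi , refl , l , g ← sorted-split (suc k) so =
  subst₂ (λ a b → p (suc k) + a ≤ b) e₁ (trans (cong (p k +_) e₂) (+-identityʳ _))
    (L (reverse hi) (reverse lo ++ w) (trans (sym (++-assoc (reverse hi) _ _)) (cong (_++ w) (sym (reverse-++ lo hi)))) k)
  where
  e₁ : count (2 + k) (reverse hi) ≡ count (2 + k) (lo ++ hi)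
  e₁ = trans (count-reverse (2 + k) hi) (sym (trans (count-++ (2 + k) lo hi)
    (cong (_+ count (2 + k) hi) (count-none lo λ x∈ x≡ → <-irrefl refl (subst (_≤ suc k) x≡ (l x∈))))))

  e₂ : count (1 + k) (reverse hi) ≡ 0
  e₂ = trans (count-reverse (1 + k) hi) (count-none hi λ x∈ x≡ → <-irrefl refl (subst (suc k <_) x≡ (g x∈)))

lattice⇒chain : ∀ {q p} t → All Sorted t → Lattice p (reading t) →
                (∀ k → p k + count (suc k) (concat t) ≡ q k) → Chain q p t
lattice⇒chain [] _ _ e = [] λ k → trans (sym (+-identityʳ _)) (e k)
lattice⇒chain {q} {p} (v ∷ t) (so ∷ sos) L e =
  lattice-strip so L ∷ lattice⇒chain t sos rest λ k →
    trans (+-assoc (p k) _ _) (trans (cong (p k +_) (sym (count-++ (suc k) v (concat t)))) (e k))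
  where
  rest : Lattice (p ⊞ v) (reading t)
  rest u u′ eq k = subst₂ _≤_ (shift (suc k)) (shift k)
    (L (reverse v ++ u) u′ (trans (++-assoc (reverse v) u u′) (cong (reverse v ++_) eq)) k)
    where
    shift : ∀ k → p k + count (suc k) (reverse v ++ u) ≡ (p ⊞ v) k + count (suc k) u
    shift k = trans (cong (p k +_) (trans (count-++ (suc k) (reverse v) u) (cong (_+ count (suc k) u) (count-reverse (suc k) v))))
      (sym (+-assoc (p k) _ _))

++-split : ∀ {A : Set} (xs us : List A) {ys vs} → us ++ vs ≡ xs ++ ys →
           (∃ λ w → us ≡ xs ++ w × w ++ vs ≡ ys) ⊎ (∃ λ w → xs ≡ us ++ w)
++-split []       us       e = inj₁ (us , refl , e)
++-split (x ∷ xs) []       e = inj₂ (x ∷ xs , refl)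
++-split (x ∷ xs) (u ∷ us) e with ∷-injective e
... | refl , e′ with ++-split xs us e′
...   | inj₁ (w , refl , h) = inj₁ (w , refl , h)
...   | inj₂ (w , refl)     = inj₂ (w , refl)

-- A prefix ending inside a row contains at most all letters `suc (suc k)` of that row, for which
-- `Strip` has made room. When no rows are left, the monotonicity of `q` remains.
chain⇒lattice : ∀ {q p t} → (∀ k → q (suc k) ≤ q k) → Chain q p t → Lattice p (reading t)
chain⇒lattice {q} {p} d ([] e) [] u′ eq k =
  +-monoˡ-≤ 0 (subst₂ _≤_ (sym (e (suc k))) (sym (e k)) (d k))
chain⇒lattice {q} {p} d (_∷_ {v = v} s c) u u′ eq k with ++-split (reverse v) u eq
... | inj₁ (w , refl , h) = subst₂ _≤_ (shift (suc k)) (shift k) (chain⇒lattice d c w u′ h k)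
  where
  shift : ∀ k → (p ⊞ v) k + count (suc k) w ≡ p k + count (suc k) (reverse v ++ w)
  shift k = trans (+-assoc (p k) _ _) (cong (p k +_) (sym
    (trans (count-++ (suc k) (reverse v) w) (cong (_+ count (suc k) w) (count-reverse (suc k) v)))))
... | inj₂ (w , e) = ≤-trans (+-monoʳ-≤ (p (suc k)) fewer) (≤-trans (s k) (m≤m+n _ _))
  where
  fewer : count (2 + k) u ≤ count (2 + k) v
  fewer = ≤-trans (m≤m+n _ (count (2 + k) w)) (≤-reflexive
    (trans (sym (count-++ (2 + k) u w)) (trans (cong (count (2 + k)) (sym e)) (count-reverse (2 + k) v))))

∈-inits⁻ : ∀ {u : List ℕ} w → u ∈ inits w → ∃ λ u′ → u ++ u′ ≡ w
∈-inits⁻ w       (here refl) = w , refl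
∈-inits⁻ (x ∷ w) (there u∈) with y , y∈ , refl ← ∈-map⁻ (x ∷_) {xs = inits w} u∈
  with u′ , refl ← ∈-inits⁻ w y∈ = u′ , refl

∈-inits⁺ : ∀ (u : List ℕ) {u′} → u ∈ inits (u ++ u′)
∈-inits⁺ []      = here refl
∈-inits⁺ (x ∷ u) {u′} = there (∈-map⁺ (x ∷_) {xs = inits (u ++ u′)} (∈-inits⁺ u))

isLattice⇒ : ∀ {m w} → (∀ {x} → x ∈ w → x ≤ m) → T (isLattice m w) → Lattice (λ _ → 0) w
isLattice⇒ {m} {w} b h u u′ refl k with k <? m
... | yes k<m = ≤ᵇ⇒≤ _ _ (All.lookup (All.all⁺ _ (oneTo m) (All.lookup (All.all⁺ _ (inits w) h) (∈-inits⁺ u)))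
  (∈-map⁺ suc (∈-upTo⁺ k<m)))
-- Beyond `m`, where the Boolean test does not look, the letter `2 + k` cannot occur.
... | no  k≮m rewrite count-none {2 + k} u (λ x∈ x≡ → k≮m (<⇒≤ (subst (_≤ m) x≡ (b (∈-++⁺ˡ x∈))))) = z≤n

isLattice⇐ : ∀ {m w} → Lattice (λ _ → 0) w → T (isLattice m w)
isLattice⇐ {m} {w} L = All.all⁻ _ {xs = inits w} (All.tabulate λ {u} u∈ → All.all⁻ _ {xs = oneTo m} (All.tabulate (letter u u∈)))
  where
  letter : ∀ u → u ∈ inits w → ∀ {k} → k ∈ oneTo m → T (count (suc k) u ≤ᵇ count k u)
  letter u u∈ k∈ with j , _ , refl ← ∈-map⁻ suc k∈ with u′ , e ← ∈-inits⁻ w u∈ = ≤⇒≤ᵇ (L u u′ e j)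

∈-reading⁻ : ∀ {x} t → x ∈ reading t → ∃ λ v → v ∈ t × x ∈ v
∈-reading⁻ (v ∷ t) x∈ with ∈-++⁻ (reverse v) x∈
... | inj₁ x∈v = v , here refl , Any.reverse⁻ x∈v
... | inj₂ x∈t with w , w∈ , x∈w ← ∈-reading⁻ t x∈t = w , there w∈ , x∈w

chain-letter : ∀ {q p t v x} → Chain q p t → v ∈ t → suc x ∈ v → 1 ≤ q x
chain-letter {x = x} c@(_∷_ {v = v} _ _) v∈ x∈ = ≤-trans (∈⇒count>0 (∈-concat⁺′ x∈ v∈))
  (≤-trans (m≤n+m _ _) (≤-reflexive (chain-content c x)))

hasContent⇒ : ∀ {ν t} → (∀ {v x} → v ∈ t → x ∈ v → x ≤ length ν) → T (hasContent ν t) →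
              ∀ k → count (suc k) (concat t) ≡ at ν k
hasContent⇒ {ν} {t} b h k with k <? length ν
... | yes k< = trans (≡ᵇ⇒≡ _ _ (All.lookup (All.all⁺ _ (oneTo (length ν)) h) (∈-map⁺ suc (∈-upTo⁺ k<)))) (part-suc ν k)
... | no  k≮ = trans (count-none (concat t) none) (sym (at-beyond ν (≮⇒≥ k≮)))
  where
  none : ∀ {x} → x ∈ concat t → x ≢ suc k
  none x∈ x≡ with v , x∈v , v∈ ← ∈-concat⁻′ t x∈ = k≮ (subst (_≤ length ν) x≡ (b v∈ x∈v))

hasContent⇐ : ∀ {ν t} → (∀ k → count (suc k) (concat t) ≡ at ν k) → T (hasContent ν t)
hasContent⇐ {ν} {t} h = All.all⁻ _ {xs = oneTo (length ν)} (All.tabulate letter)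
  where
  letter : ∀ {k} → k ∈ oneTo (length ν) → T (count k (concat t) ≡ᵇ part ν k)
  letter k∈ with j , _ , refl ← ∈-map⁻ suc k∈ = ≡⇒≡ᵇ _ _ (trans (h j) (sym (part-suc ν j)))

weaklyIncr⇒ : ∀ v → T (weaklyIncr v) → Sorted v
weaklyIncr⇒ []          h = []
weaklyIncr⇒ (x ∷ [])    h = [] ∷ []
weaklyIncr⇒ (x ∷ y ∷ v) h = extend (≤ᵇ⇒≤ x y (proj₁ c)) (weaklyIncr⇒ (y ∷ v) (proj₂ c))
  where
  c = to (T-∧ {x ≤ᵇ y}) h

  extend : x ≤ y → Sorted (y ∷ v) → Sorted (x ∷ y ∷ v)
  extend x≤y (a ∷ s) = (x≤y ∷ All.map (≤-trans x≤y) a) ∷ a ∷ s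

weaklyIncr⇐ : ∀ {v} → Sorted v → T (weaklyIncr v)
weaklyIncr⇐ []                      = _
weaklyIncr⇐ ([] ∷ [])               = _
weaklyIncr⇐ {x ∷ y ∷ _} ((x≤y ∷ _) ∷ s) = from (T-∧ {x ≤ᵇ y}) (≤⇒≤ᵇ x≤y , weaklyIncr⇐ s)

-- The list of all fillings

RowFilling : ℕ → ℕ → List ℕ → Set
RowFilling m r v = length v ≡ r × (∀ {x} → x ∈ v → 1 ≤ x × x ≤ m)

concatMap-∷ : ∀ {A : Set} (xs : List A) ys → concatMap (λ x → map (x ∷_) ys) xs ≡ cartesianProductWith List._∷_ xs ys
concatMap-∷ []       ys = refl
concatMap-∷ (x ∷ xs) ys = cong (map (x ∷_) ys ++_) (concatMap-∷ xs ys)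

module _ {A : Set} {xs : List A} {ys : List (List A)} where
  ∈-concatMap-∷⁻ : ∀ {w} → w ∈ concatMap (λ x → map (x ∷_) ys) xs → ∃ λ x → ∃ λ y → x ∈ xs × y ∈ ys × w ≡ x ∷ y
  ∈-concatMap-∷⁻ w∈ with x , y , x∈ , y∈ , e ← ∈-cartesianProductWith⁻ List._∷_ xs ys (subst (_ ∈_) (concatMap-∷ xs ys) w∈) =
    x , y , x∈ , y∈ , e

  ∈-concatMap-∷⁺ : ∀ {x y} → x ∈ xs → y ∈ ys → x ∷ y ∈ concatMap (λ x → map (x ∷_) ys) xs
  ∈-concatMap-∷⁺ x∈ y∈ = subst (_ ∈_) (sym (concatMap-∷ xs ys)) (∈-cartesianProductWith⁺ List._∷_ x∈ y∈)

  -- `lrCoeff` is the length of a filtered list, so multiplicity one requires that no filling is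
  -- listed twice.
  unique-concatMap-∷ : Unique xs → Unique ys → Unique (concatMap (λ x → map (x ∷_) ys) xs)
  unique-concatMap-∷ u v = subst Unique (sym (concatMap-∷ xs ys)) (Unique.cartesianProductWith⁺ List._∷_ ∷-injective u v)

words⁻ : ∀ m n {v} → v ∈ words m n → RowFilling m n v
words⁻ m zero    (here refl) = refl , λ ()
words⁻ m (suc n) v∈ with x , y , x∈ , y∈ , refl ← ∈-concatMap-∷⁻ {xs = oneTo m} {words m n} v∈
  with j , j∈ , refl ← ∈-map⁻ suc x∈ with len , b ← words⁻ m n y∈ =
  cong suc len , λ { (here refl) → s≤s z≤n , ∈-upTo⁻ j∈ ; (there z∈) → b z∈ }

words⁺ : ∀ m n {v} → RowFilling m n v → v ∈ words m n
words⁺ m zero    {[]}        (len , b) = here refl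
words⁺ m (suc n) {zero ∷ v}  (len , b) = contradiction (proj₁ (b (here refl))) λ ()
words⁺ m (suc n) {suc x ∷ v} (len , b) =
  ∈-concatMap-∷⁺ {xs = oneTo m} (∈-map⁺ suc (∈-upTo⁺ (proj₂ (b (here refl))))) (words⁺ m n (suc-injective len , b ∘ there))

words-unique : ∀ m n → Unique (words m n)
words-unique m zero    = [] ∷ []
words-unique m (suc n) = unique-concatMap-∷ (Unique.map⁺ suc-injective (Unique.upTo⁺ m)) (words-unique m n)

choices⁻ : ∀ m rs {t} → t ∈ choices (map (words m) rs) → Pointwise (RowFilling m) rs t
choices⁻ m []       (here refl) = []
choices⁻ m (r ∷ rs) t∈ with x , y , x∈ , y∈ , refl ← ∈-concatMap-∷⁻ {xs = words m r} t∈ = words⁻ m r x∈ ∷ choices⁻ m rs y∈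

choices⁺ : ∀ m {rs t} → Pointwise (RowFilling m) rs t → t ∈ choices (map (words m) rs)
choices⁺ m []       = here refl
choices⁺ m (r ∷ rs) = ∈-concatMap-∷⁺ (words⁺ m _ r) (choices⁺ m rs)

choices-unique : ∀ m rs → Unique (choices (map (words m) rs))
choices-unique m []       = [] ∷ []
choices-unique m (r ∷ rs) = unique-concatMap-∷ (words-unique m r) (choices-unique m rs)

unique-length-one : ∀ {A : Set} {x : A} {xs} → Unique xs → x ∈ xs → (∀ {y} → y ∈ xs → y ≡ x) → length xs ≡ 1
unique-length-one {xs = _ ∷ []}     u _ h = refl
unique-length-one {xs = _ ∷ _ ∷ _} ((a≢b ∷ _) ∷ _) _ h =
  contradiction (trans (h (here refl)) (sym (h (there (here refl))))) a≢b

length-filter-one : ∀ {A : Set} (p : A → Bool) {x xs} → Unique xs → x ∈ xs → T (p x) →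
                    (∀ {y} → y ∈ xs → T (p y) → y ≡ x) → length (filterᵇ p xs) ≡ 1
length-filter-one p {xs = xs} u x∈ px h = unique-length-one (Unique.filter⁺ (T? ∘ p) u) (∈-filter⁺ (T? ∘ p) x∈ px)
  λ y∈ → let y∈′ , py = ∈-filter⁻ (T? ∘ p) {xs = xs} y∈ in h y∈′ py

length-filter-zero : ∀ {A : Set} (p : A → Bool) xs → length (filterᵇ p xs) ≢ 0 → ∃ λ x → x ∈ xs × T (p x)
length-filter-zero p xs h with filterᵇ p xs in eq
... | []    = contradiction refl h
... | x ∷ _ = x , ∈-filter⁻ (T? ∘ p) {xs = xs} (subst (x ∈_) (sym eq) (here refl))

-- The position of the two pieces

-- The upper right piece α has its corner at `(suc a , suc b)`, the lower left piece β at
-- `(suc c , suc d)`. In the other rows λ and μ may have boxes, but their difference is empty.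
record Layout (la mu α β : List ℕ) : Set where
  field
    a b c d : ℕ
    α-μ  : ∀ {i} → i < length α → part mu (suc (a + i)) ≡ b
    α-λ  : ∀ {i} → i < length α → part la (suc (a + i)) ≡ b + at α i
    β-μ  : ∀ {i} → i < length β → part mu (suc (c + i)) ≡ d
    β-λ  : ∀ {i} → i < length β → part la (suc (c + i)) ≡ d + at β i
    gap  : ∀ {i} → ¬ (a ≤ i × i < a + length α) → ¬ (c ≤ i × i < c + length β) →
           part la (suc i) ∸ part mu (suc i) ≡ 0
    rows : a + length α ≤ c
    cols : d + at β 0 ≤ b
    fits : c + length β ≤ length la

-- A nonempty interval is determined by its least and greatest elements; these are tested against
-- the other interval in both directions.
interval-unique : ∀ {m l b k} → 1 ≤ k →
                  (∀ {j} → b < j → j ≤ b + k → m < j × j ≤ l) →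
                  (∀ {j} → m < j → j ≤ l → b < j × j ≤ b + k) → m ≡ b × l ≡ b + k
interval-unique {m} {l} {b} {k} 1≤k f g with f (m<m+n b 1≤k) ≤-refl | f {suc b} ≤-refl (m<m+n b 1≤k)
... | m<b+k , b+k≤l | m<b+1 , b<l =
  ≤-antisym (≤-pred m<b+1) (≤-pred (proj₁ (g {suc m} ≤-refl (≤-trans m<b+1 b<l)))) ,
  ≤-antisym (proj₂ (g (≤-trans m<b+1 b<l) ≤-refl)) b+k≤l

translate-row : ∀ α {a b i j} → InTranslate α a b (i , j) → ∃ λ k → i ≡ suc (a + k) × k < length α × b < j × j ≤ b + at α k
translate-row α {a} {b} (suc k , j′ , (_ , 1≤j , j≤) , refl , refl) =
  k , cong suc (+-comm k a) , at-positive⁻ α (≤-trans 1≤j j≤′) ,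
  subst (_≤ j′ + b) refl (+-monoˡ-≤ b 1≤j) , subst (j′ + b ≤_) (+-comm (at α k) b) (+-monoˡ-≤ b j≤′)
  where
  j≤′ = subst (j′ ≤_) (part-suc α k) j≤

row-translate : ∀ α {a b k j} → b < j → j ≤ b + at α k → InTranslate α a b (suc (a + k) , j)
row-translate α {a} {b} {k} {j} b<j j≤ = suc k , j ∸ b ,
  (s≤s z≤n , m<n⇒0<n∸m b<j , subst (j ∸ b ≤_) (sym (part-suc α k)) (m≤n+o⇒m∸n≤o j b j≤)) ,
  cong suc (+-comm a k) , sym (m∸n+n≡m (<⇒≤ b<j))

Disjoint : (Box → Set) → (Box → Set) → Set
Disjoint X Y = ∀ i j i′ j′ → X (i , j) → Y (i′ , j′) → ¬ (i ≡ i′) × ¬ (j ≡ j′)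

module _ {la mu α β a b c d}
         (D : ∀ x → InSkew la mu x ⇔ (InTranslate α a b x ⊎ InTranslate β c d x))
         (dis : Disjoint (InTranslate α a b) (InTranslate β c d)) (Pα : IsPartition α) where

  -- Disjointness keeps the other piece out of this row, so the skew diagram meets it in a single
  -- interval, that of the piece.
  piece-row : ∀ {i} → i < length α → part mu (suc (a + i)) ≡ b × part la (suc (a + i)) ≡ b + at α i
  piece-row {i} i< = interval-unique pos
    (λ {j} b<j j≤ → let (_ , _ , j≤l) , ¬m = from (D (suc (a + i) , j)) (inj₁ (row-translate α b<j j≤)) in
      ≰⇒> (λ j≤m → ¬m (s≤s z≤n , ≤-trans (s≤s z≤n) b<j , j≤m)) , j≤l)
    (λ {j} m<j j≤l → in-piece (to (D (suc (a + i) , j))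
      ((s≤s z≤n , ≤-trans (s≤s z≤n) m<j , j≤l) , λ (_ , _ , j≤m) → <⇒≱ m<j j≤m)))
    where
    pos : 1 ≤ at α i
    pos = at-positive Pα i<

    in-piece : ∀ {j} → InTranslate α a b (suc (a + i) , j) ⊎ InTranslate β c d (suc (a + i) , j) → b < j × j ≤ b + at α i
    in-piece (inj₁ t) with k , e , _ , b<j , j≤ ← translate-row α t =
      b<j , subst (λ n → _ ≤ b + at α n) (sym (+-cancelˡ-≡ a i k (suc-injective e))) j≤
    in-piece (inj₂ t) = contradiction refl (proj₁ (dis _ _ _ _ (row-translate α {b = b} ≤-refl (m<m+n b pos)) t))

module _ {la mu α β a b c d}
         (D : ∀ x → InSkew la mu x ⇔ (InTranslate α a b x ⊎ InTranslate β c d x))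
         (dis : Disjoint (InTranslate α a b) (InTranslate β c d))
         (Pμ : IsPartition mu) (Pα : IsPartition α) (Pβ : IsPartition β)
         (α≢[] : ¬ (α ≡ [])) (β≢[] : ¬ (β ≡ [])) where
  private
    nonempty : ∀ {γ : List ℕ} → ¬ (γ ≡ []) → 0 < length γ
    nonempty {[]}    h = contradiction refl h
    nonempty {_ ∷ _} h = s≤s z≤n

    D′ : ∀ x → InSkew la mu x ⇔ (InTranslate β c d x ⊎ InTranslate α a b x)
    D′ x = mk⇔ (Sum.swap ∘ to (D x)) (from (D x) ∘ Sum.swap)

    dis′ : Disjoint (InTranslate β c d) (InTranslate α a b)
    dis′ i j i′ j′ x y = let p , q = dis i′ j′ i j y x in p ∘ sym , q ∘ sym

    rowα : ∀ {i} → i < length α → part mu (suc (a + i)) ≡ b × part la (suc (a + i)) ≡ b + at α i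
    rowα = piece-row {la} {mu} {α} {β} D dis Pα

    rowβ : ∀ {i} → i < length β → part mu (suc (c + i)) ≡ d × part la (suc (c + i)) ≡ d + at β i
    rowβ = piece-row {la} {mu} {β} {α} D′ dis′ Pβ

    β-first : InTranslate β c d (suc c , suc d)
    β-first = subst (λ k → InTranslate β c d (suc k , suc d)) (+-identityʳ c)
      (row-translate β ≤-refl (m<m+n d (at-positive Pβ (nonempty β≢[]))))

    in-rows : ∀ γ {e f i j} → InTranslate γ e f (suc i , j) → e ≤ i × i < e + length γ
    in-rows γ {e} t with k , refl , k< , _ ← translate-row γ t = m≤m+n e k , +-monoʳ-< e k<

    gaps : ∀ {i} → ¬ (a ≤ i × i < a + length α) → ¬ (c ≤ i × i < c + length β) → part la (suc i) ∸ part mu (suc i) ≡ 0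
    gaps {i} ¬α ¬β with part la (suc i) ≤? part mu (suc i)
    ... | yes h = m≤n⇒m∸n≡0 h
    ... | no  h with to (D (suc i , part la (suc i)))
                       ((s≤s z≤n , ≤-trans (s≤s z≤n) (≰⇒> h) , ≤-refl) , λ (_ , _ , le) → h le)
    ...   | inj₁ t = contradiction (in-rows α t) ¬α
    ...   | inj₂ t = contradiction (in-rows β t) ¬β

  layout : a ≤ c → Layout la mu α β
  layout a≤c = record
    { a = a ; b = b ; c = c ; d = d
    ; α-μ = proj₁ ∘ rowα ; α-λ = proj₂ ∘ rowα ; β-μ = proj₁ ∘ rowβ ; β-λ = proj₂ ∘ rowβ
    ; gap = gaps ; rows = rows ; cols = cols ; fits = fits β refl }
    where
    rows : a + length α ≤ c
    rows with a + length α ≤? c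
    ... | yes h = h
    ... | no  h = contradiction refl (proj₁ (dis _ _ _ _ same-row β-first))
      where
      c∸a< : c ∸ a < length α
      c∸a< = +-cancelˡ-< a _ _ (subst (_< a + length α) (sym (m+[n∸m]≡n a≤c)) (≰⇒> h))

      same-row : InTranslate α a b (suc c , suc b)
      same-row = subst (λ k → InTranslate α a b (suc k , suc b)) (m+[n∸m]≡n a≤c)
        (row-translate α ≤-refl (m<m+n b (at-positive Pα c∸a<)))

    -- `b` and `d` are the parts of μ in rows `suc a` and `suc c`. So if β reached beyond column
    -- `b`, its first row would meet column `suc b`, where α begins.
    d≤b : d ≤ b
    d≤b = subst₂ _≤_ (trans (sym (part-suc mu c)) (trans (cong (part mu ∘ suc) (sym (+-identityʳ c))) (proj₁ (rowβ (nonempty β≢[])))))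
                     (trans (sym (part-suc mu a)) (trans (cong (part mu ∘ suc) (sym (+-identityʳ a))) (proj₁ (rowα (nonempty α≢[])))))
                     (at-antitone Pμ a≤c)

    cols : d + at β 0 ≤ b
    cols with d + at β 0 ≤? b
    ... | yes h = h
    ... | no  h = contradiction refl (proj₂ (dis _ _ _ _
      (row-translate α {k = 0} ≤-refl (m<m+n b (at-positive Pα (nonempty α≢[]))))
      (row-translate β {k = 0} (s≤s d≤b) (≰⇒> h))))

    fits : ∀ γ → γ ≡ β → c + length γ ≤ length la
    fits []       e = contradiction (sym e) β≢[]
    fits (y ∷ ys) refl = subst (_≤ length la) (sym (+-suc c (length ys))) (at-positive⁻ la (subst (1 ≤_)
      (trans (sym (proj₂ (rowβ (≤-refl {suc (length ys)})))) (part-suc la _))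
      (≤-trans (at-positive Pβ ≤-refl) (m≤n+m _ d))))

decompose : ∀ {la mu α β} → IsPartition mu → IsPartition α → IsPartition β → ¬ (α ≡ []) → ¬ (β ≡ []) →
            DecomposesInto la mu α β → Layout la mu α β ⊎ Layout la mu β α
decompose {la} {mu} {α} {β} Pμ Pα Pβ α≢[] β≢[] (a , b , c , d , D , dis) with ≤-total a c
... | inj₁ a≤c = inj₁ (layout {la} {mu} {α} {β} D dis Pμ Pα Pβ α≢[] β≢[] a≤c)
... | inj₂ c≤a = inj₂ (layout {la} {mu} {β} {α} (λ x → mk⇔ (Sum.swap ∘ to (D x)) (from (D x) ∘ Sum.swap))
  (λ i j i′ j′ x y → let p , q = dis i′ j′ i j y x in p ∘ sym , q ∘ sym) Pμ Pβ Pα β≢[] α≢[] c≤a)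

-- The rows of the skew diagram as consecutive blocks

applyUpTo-+ : ∀ {X : Set} (G : ℕ → X) m n → applyUpTo G (m + n) ≡ applyUpTo G m ++ applyUpTo (G ∘ (m +_)) n
applyUpTo-+ G zero    n = refl
applyUpTo-+ G (suc m) n = cong (G 0 ∷_) (applyUpTo-+ (G ∘ suc) m n)

applyUpTo-cong : ∀ {X : Set} {G H : ℕ → X} n → (∀ {i} → i < n → G i ≡ H i) → applyUpTo G n ≡ applyUpTo H n
applyUpTo-cong zero    h = refl
applyUpTo-cong (suc n) h = cong₂ _∷_ (h (s≤s z≤n)) (applyUpTo-cong n (h ∘ s≤s))

applyUpTo-const : ∀ {X : Set} {G : ℕ → X} {z} n → (∀ {i} → i < n → G i ≡ z) → applyUpTo G n ≡ replicate n z
applyUpTo-const zero    h = refl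
applyUpTo-const (suc n) h = cong₂ _∷_ (h (s≤s z≤n)) (applyUpTo-const n (h ∘ s≤s))

applyUpTo-at : ∀ xs → applyUpTo (at xs) (length xs) ≡ xs
applyUpTo-at []       = refl
applyUpTo-at (x ∷ xs) = cong (x ∷_) (applyUpTo-at xs)

applyUpTo-boxes : ∀ a b xs → concat (applyUpTo (λ i → rowBoxes (suc (a + i)) b (at xs i)) (length xs)) ≡ boxes a b xs
applyUpTo-boxes a b []       = refl
applyUpTo-boxes a b (x ∷ xs) = cong₂ _++_ (cong (λ k → rowBoxes (suc k) b x) (+-identityʳ a))
  (trans (cong concat (applyUpTo-cong (length xs) λ {i} _ → cong (λ k → rowBoxes (suc k) b (at xs i)) (+-suc a i)))
    (applyUpTo-boxes (suc a) b xs))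

concat-replicate-[] : ∀ {X : Set} n → concat (replicate n ([] {A = X})) ≡ []
concat-replicate-[] zero    = refl
concat-replicate-[] (suc n) = concat-replicate-[] n

module _ {la mu α β} (Λ : Layout la mu α β) where
  open Layout Λ

  gapLength tailLength : ℕ
  gapLength  = c ∸ (a + length α)
  tailLength = length la ∸ (c + length β)

  -- Row lengths, rows of boxes and rows of fillings all have this form, with `z` standing for an
  -- empty row above, between and below the pieces.
  arrange : ∀ {X : Set} → X → List X → List X → List X
  arrange z A B = replicate a z ++ (A ++ (replicate gapLength z ++ (B ++ replicate tailLength z)))

  private
    c≡ : a + (length α + gapLength) ≡ c
    c≡ = trans (sym (+-assoc a _ _)) (m+[n∸m]≡n rows)

    shift-c : ∀ i → a + (length α + (gapLength + i)) ≡ c + i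
    shift-c i = trans (cong (a +_) (sym (+-assoc (length α) gapLength i))) (trans (sym (+-assoc a _ i)) (cong (_+ i) c≡))

    total : a + (length α + (gapLength + (length β + tailLength))) ≡ length la
    total = trans (shift-c _) (trans (sym (+-assoc c _ _)) (m+[n∸m]≡n fits))

  applyUpTo-layout : ∀ {X : Set} {G Gα Gβ : ℕ → X} {z} →
    (∀ {i} → ¬ (a ≤ i × i < a + length α) → ¬ (c ≤ i × i < c + length β) → G i ≡ z) →
    (∀ {i} → i < length α → G (a + i) ≡ Gα i) → (∀ {i} → i < length β → G (c + i) ≡ Gβ i) →
    applyUpTo G (length la) ≡ arrange z (applyUpTo Gα (length α)) (applyUpTo Gβ (length β))
  applyUpTo-layout {G = G} {Gα} {Gβ} {z} hz hα hβ = begin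
    applyUpTo G (length la)
      ≡⟨ cong (applyUpTo G) (sym total) ⟩
    applyUpTo G (a + (length α + (gapLength + (length β + tailLength))))
      ≡⟨ applyUpTo-+ G a _ ⟩
    applyUpTo G a ++ applyUpTo G₁ (length α + (gapLength + (length β + tailLength)))
      ≡⟨ cong₂ _++_ before (applyUpTo-+ G₁ (length α) _) ⟩
    replicate a z ++ (applyUpTo G₁ (length α) ++ applyUpTo G₂ (gapLength + (length β + tailLength)))
      ≡⟨ cong (replicate a z ++_) (cong₂ _++_ (applyUpTo-cong (length α) hα) (applyUpTo-+ G₂ gapLength _)) ⟩
    replicate a z ++ (applyUpTo Gα (length α) ++ (applyUpTo G₂ gapLength ++ applyUpTo G₃ (length β + tailLength)))
      ≡⟨ cong (λ R → replicate a z ++ (applyUpTo Gα (length α) ++ R))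
           (cong₂ _++_ between (trans (applyUpTo-+ G₃ (length β) _) (cong₂ _++_
             (applyUpTo-cong (length β) λ {i} h → trans (cong G (shift-c i)) (hβ h)) after))) ⟩
    arrange z (applyUpTo Gα (length α)) (applyUpTo Gβ (length β)) ∎
    where
    open ≡-Reasoning
    G₁ = G ∘ (a +_)
    G₂ = G₁ ∘ (length α +_)
    G₃ = G₂ ∘ (gapLength +_)

    before : applyUpTo G a ≡ replicate a z
    before = applyUpTo-const a λ i<a → hz (λ (a≤i , _) → <⇒≱ i<a a≤i)
      (λ (c≤i , _) → <⇒≱ i<a (≤-trans (≤-trans (m≤m+n a _) rows) c≤i))

    between : applyUpTo G₂ gapLength ≡ replicate gapLength z
    between = applyUpTo-const gapLength λ {i} h → hz
      (λ (_ , lt) → <⇒≱ lt (+-monoʳ-≤ a (m≤m+n (length α) i)))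
      (λ (c≤ , _) → <⇒≱ (subst (a + (length α + i) <_) c≡ (+-monoʳ-< a (+-monoʳ-< (length α) h))) c≤)

    after : applyUpTo (G₃ ∘ (length β +_)) tailLength ≡ replicate tailLength z
    after = applyUpTo-const tailLength λ {i} h → trans (cong G (shift-c (length β + i))) (hz
      (λ (_ , lt) → <⇒≱ lt (≤-trans rows (m≤m+n c _)))
      (λ (_ , lt) → <⇒≱ lt (+-monoʳ-≤ c (m≤m+n (length β) i))))

  private
    rowLength : ℕ → ℕ
    rowLength i = part la (suc i) ∸ part mu (suc i)

    α-length : ∀ {i} → i < length α → rowLength (a + i) ≡ at α i
    α-length {i} i< rewrite α-μ i< | α-λ i< = m+n∸m≡n b (at α i)

    β-length : ∀ {i} → i < length β → rowLength (c + i) ≡ at β i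
    β-length {i} i< rewrite β-μ i< | β-λ i< = m+n∸m≡n d (at β i)

  rowLengths : map (λ i → part la i ∸ part mu i) (oneTo (length la)) ≡ arrange 0 α β
  rowLengths = begin
    map (λ i → part la i ∸ part mu i) (oneTo (length la)) ≡⟨ map-∘ (upTo (length la)) ⟨
    map rowLength (upTo (length la))                       ≡⟨ map-upTo rowLength (length la) ⟩
    applyUpTo rowLength (length la)                        ≡⟨ applyUpTo-layout gap α-length β-length ⟩
    arrange 0 (applyUpTo (at α) (length α)) (applyUpTo (at β) (length β))
      ≡⟨ cong₂ (arrange 0) (applyUpTo-at α) (applyUpTo-at β) ⟩
    arrange 0 α β ∎
    where open ≡-Reasoning

  skewBoxes-layout : skewBoxes la mu ≡ boxes a b α ++ boxes c d β
  skewBoxes-layout = begin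
    skewBoxes la mu                    ≡⟨ cong concat (trans (sym (map-∘ (upTo (length la)))) (map-upTo R (length la))) ⟩
    concat (applyUpTo R (length la))   ≡⟨ cong concat (applyUpTo-layout {G = R} {Rα} {Rβ} {[]} Rgap Rα≡ Rβ≡) ⟩
    concat (arrange [] A B)            ≡⟨ sym (concat-++ (replicate a []) _) ⟩
    concat (replicate a []) ++ concat (A ++ (replicate gapLength [] ++ (B ++ replicate tailLength [])))
      ≡⟨ cong₂ _++_ (concat-replicate-[] a) (sym (concat-++ A _)) ⟩
    concat A ++ concat (replicate gapLength [] ++ (B ++ replicate tailLength []))
      ≡⟨ cong₂ _++_ (applyUpTo-boxes a b α) (trans (sym (concat-++ (replicate gapLength []) _)) (cong₂ _++_ (concat-replicate-[] gapLength) (sym (concat-++ B _)))) ⟩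
    boxes a b α ++ (concat B ++ concat (replicate tailLength []))
      ≡⟨ cong (boxes a b α ++_) (trans (cong₂ _++_ (applyUpTo-boxes c d β) (concat-replicate-[] tailLength)) (++-identityʳ _)) ⟩
    boxes a b α ++ boxes c d β ∎
    where
    open ≡-Reasoning
    R Rα Rβ : ℕ → List Box
    R i  = rowBoxes (suc i) (part mu (suc i)) (rowLength i)
    Rα i = rowBoxes (suc (a + i)) b (at α i)
    Rβ i = rowBoxes (suc (c + i)) d (at β i)
    A = applyUpTo Rα (length α)
    B = applyUpTo Rβ (length β)

    Rgap : ∀ {i} → ¬ (a ≤ i × i < a + length α) → ¬ (c ≤ i × i < c + length β) → R i ≡ []
    Rgap {i} h₁ h₂ = cong (rowBoxes (suc i) (part mu (suc i))) (gap h₁ h₂)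

    Rα≡ : ∀ {i} → i < length α → R (a + i) ≡ Rα i
    Rα≡ {i} h = cong₂ (rowBoxes (suc (a + i))) (α-μ h) (α-length h)

    Rβ≡ : ∀ {i} → i < length β → R (c + i) ≡ Rβ i
    Rβ≡ {i} h = cong₂ (rowBoxes (suc (c + i))) (β-μ h) (β-length h)

  πnw-layout : IsPartition α → IsPartition β → hl α ⊕ hl β ≡ πnw la mu
  πnw-layout Pα Pβ rewrite skewBoxes-layout = sym (nwLengths-boxes _ Pα Pβ rows cols
    (≤-trans (+-mono-≤ (length-boxes a b Pα) (length-boxes c d Pβ)) (≤-reflexive (sym (length-++ (boxes a b α))))))

-- Fillings of the skew diagram and tableaux

-- The lower of two adjacent rows decides which columns are compared; `rowOf` counts rows from 1,
-- `at` from 0.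
Cols : List ℕ → List (List ℕ) → Set
Cols β t = ∀ i {s} → s < at β (suc i) → at (rowOf t (suc i)) s < at (rowOf t (suc (suc i))) s

tab-intro : ∀ {m q f p β t} → Pointwise (RowFilling m) β t → All Sorted t → Chain q p t →
            (∀ {s} → s < at β 0 → f s < at (rowOf t 1) s) → Cols β t → Tab q f p β t
tab-intro []               []         ([] e)   hf h = [] e
tab-intro ((refl , _) ∷ F) (so ∷ sos) (st ∷ c) hf h = row refl so hf st (tab-intro F sos c (h 0) (h ∘ suc))

tab-sorted : ∀ {q f p β t} → Tab q f p β t → All Sorted t
tab-sorted ([] _)           = []
tab-sorted (row _ so _ _ t) = so ∷ tab-sorted t

tab-chain : ∀ {q f p β t} → Tab q f p β t → Chain q p t
tab-chain ([] e)           = [] e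
tab-chain (row _ _ _ st t) = st ∷ tab-chain t

tab-cols : ∀ {q f p β t} → Tab q f p β t → Cols β t
tab-cols ([] _) i ()
tab-cols (row _ _ _ _ (row refl _ ab _ _)) zero    s< = ab s<
tab-cols (row _ _ _ _ ([] _))              zero    ()
tab-cols (row _ _ _ _ t)                   (suc i) s< = tab-cols t i s<

tab-filling : ∀ {m q f p β t} → (∀ {v x} → v ∈ t → x ∈ v → x ≤ m) → Tab q f p β t → Pointwise (RowFilling m) β t
tab-filling b ([] _) = []
tab-filling b (row len _ ab _ t) =
  (len , λ x∈ → above-letters (λ _ → z≤n) ab x∈ , b (here refl) x∈) ∷ tab-filling (b ∘ there) t

pointwise-++⁻ : ∀ {R : ℕ → List ℕ → Set} xs {ys t} → Pointwise R (xs ++ ys) t →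
                ∃ λ t₁ → ∃ λ t₂ → t ≡ t₁ ++ t₂ × Pointwise R xs t₁ × Pointwise R ys t₂
pointwise-++⁻ []       F       = [] , _ , refl , [] , F
pointwise-++⁻ (x ∷ xs) (f ∷ F) with t₁ , t₂ , refl , F₁ , F₂ ← pointwise-++⁻ xs F =
  _ ∷ t₁ , t₂ , refl , f ∷ F₁ , F₂

empty-rows⁻ : ∀ {m} n {t} → Pointwise (RowFilling m) (replicate n 0) t → t ≡ replicate n []
empty-rows⁻ zero    []                  = refl
empty-rows⁻ (suc n) {[] ∷ t} (_ ∷ F)    = cong ([] ∷_) (empty-rows⁻ n F)
empty-rows⁻ (suc n) {(_ ∷ _) ∷ t} ((() , _) ∷ F)

empty-rows⁺ : ∀ {m} n → Pointwise (RowFilling m) (replicate n 0) (replicate n [])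
empty-rows⁺ zero    = []
empty-rows⁺ (suc n) = (refl , λ ()) ∷ empty-rows⁺ n

rowOf-++ˡ : ∀ t {u i} → i < length t → rowOf (t ++ u) (suc i) ≡ rowOf t (suc i)
rowOf-++ˡ (v ∷ t) {i = zero}  _         = refl
rowOf-++ˡ (v ∷ t) {i = suc i} (s≤s i<n) = rowOf-++ˡ t i<n

rowOf-++ʳ : ∀ t {u} i → rowOf (t ++ u) (suc (length t + i)) ≡ rowOf u (suc i)
rowOf-++ʳ []      i = refl
rowOf-++ʳ (v ∷ t) i = rowOf-++ʳ t i

rowOf-replicate-++ : ∀ n {u} i → rowOf (replicate n [] ++ u) (suc (n + i)) ≡ rowOf u (suc i)
rowOf-replicate-++ zero    i = refl
rowOf-replicate-++ (suc n) i = rowOf-replicate-++ n i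

filling-positive : ∀ {m β t} → Pointwise (RowFilling m) β t → ∀ {s} → s < at β 0 → 0 < at (rowOf t 1) s
filling-positive (_∷_ {y = v} (refl , b) F) s< = proj₁ (b (at-∈ v s<))

module _ {la mu α β} (Λ : Layout la mu α β) (Pα : IsPartition α) (Pβ : IsPartition β) where
  open Layout Λ

  frame : List (List ℕ) → List (List ℕ) → List (List ℕ)
  frame = arrange Λ []

  private
    g = gapLength Λ
    e = tailLength Λ

  fillings≡ : ∀ m → fillings la mu m ≡ choices (map (words m) (arrange Λ 0 α β))
  fillings≡ m = cong choices (trans (map-∘ (oneTo (length la))) (cong (map (words m)) (rowLengths Λ)))

  fillings-unique : ∀ m → Unique (fillings la mu m)
  fillings-unique m = subst Unique (sym (fillings≡ m)) (choices-unique m (arrange Λ 0 α β))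

  fillings⁻ : ∀ {m t} → t ∈ fillings la mu m →
              ∃ λ A → ∃ λ B → t ≡ frame A B × Pointwise (RowFilling m) α A × Pointwise (RowFilling m) β B
  fillings⁻ {m} {t} t∈
    with t₁ , r₁ , refl , F₁ , G₁ ← pointwise-++⁻ (replicate a 0) (choices⁻ m _ (subst (t ∈_) (fillings≡ m) t∈))
    with A  , r₂ , refl , FA , G₂ ← pointwise-++⁻ α G₁
    with t₃ , r₃ , refl , F₃ , G₃ ← pointwise-++⁻ (replicate g 0) G₂
    with B  , t₅ , refl , FB , F₅ ← pointwise-++⁻ β G₃
    with refl ← empty-rows⁻ a F₁ with refl ← empty-rows⁻ g F₃ with refl ← empty-rows⁻ e F₅ = A , B , refl , FA , FB

  fillings⁺ : ∀ {m A B} → Pointwise (RowFilling m) α A → Pointwise (RowFilling m) β B → frame A B ∈ fillings la mu m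
  fillings⁺ {m} FA FB = subst (_ ∈_) (sym (fillings≡ m)) (choices⁺ m
    (Pointwise.++⁺ (empty-rows⁺ a) (Pointwise.++⁺ FA (Pointwise.++⁺ (empty-rows⁺ g) (Pointwise.++⁺ FB (empty-rows⁺ e))))))

  ColumnStrict : List (List ℕ) → Set
  ColumnStrict t = ∀ {i j} → (i , j) ∈ skewBoxes la mu → (suc i , j) ∈ skewBoxes la mu →
                   entry mu t (i , j) < entry mu t (suc i , j)

  private
    strictAt : List (List ℕ) → Box → Bool
    strictAt t (i , j) = if memB (suc i , j) (skewBoxes la mu) then entry mu t (i , j) <ᵇ entry mu t (suc i , j) else true

  isSSYT⇒ : ∀ t → T (isSSYT la mu t) → All Sorted t × ColumnStrict t
  isSSYT⇒ t h with h₁ , h₂ ← to (T-∧ {and (map weaklyIncr t)}) h =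
    All.map (weaklyIncr⇒ _) (All.all⁺ weaklyIncr t h₁) ,
    λ {i} {j} x∈ y∈ → strict {i} {j} (∈⇒memB y∈) (All.lookup (All.all⁺ _ (skewBoxes la mu) h₂) x∈)
    where
    strict : ∀ {i j} → T (memB (suc i , j) (skewBoxes la mu)) → T (strictAt t (i , j)) →
             entry mu t (i , j) < entry mu t (suc i , j)
    strict {i} {j} m h with memB (suc i , j) (skewBoxes la mu)
    ... | true = <ᵇ⇒< _ _ h

  isSSYT⇐ : ∀ t → All Sorted t → ColumnStrict t → T (isSSYT la mu t)
  isSSYT⇐ t so cs = from (T-∧ {and (map weaklyIncr t)})
    (All.all⁻ weaklyIncr (All.map weaklyIncr⇐ so) , All.all⁻ _ {xs = skewBoxes la mu} (All.tabulate λ {x} x∈ → strict x x∈))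
    where
    strict : ∀ x → x ∈ skewBoxes la mu → T (strictAt t x)
    strict (i , j) x∈ with memB (suc i , j) (skewBoxes la mu) in eq
    ... | false = _
    ... | true  = <⇒<ᵇ (cs x∈ (memB⇒∈ (skewBoxes la mu) (from T-≡ eq)))

  module _ {A B : List (List ℕ)} (lenA : length α ≡ length A) (lenB : length β ≡ length B) where
    private
      entry≡ : ∀ {t v i s k} → rowOf t (suc i) ≡ v → part mu (suc i) ≡ k → entry mu t (suc i , k + suc s) ≡ at v s
      entry≡ {t} {v} {i} {s} {k} refl refl =
        cong (at v) (trans (cong (_∸ suc k) (+-suc k s)) (m+n∸m≡n k s))

      entry-α : ∀ {i s} → i < length α → entry mu (frame A B) (suc (a + i) , b + suc s) ≡ at (rowOf A (suc i)) s
      entry-α {i} i< = entry≡ {frame A B}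
        (trans (rowOf-replicate-++ a i) (rowOf-++ˡ A (subst (i <_) lenA i<))) (α-μ i<)

      entry-β : ∀ {i s} → i < length β → entry mu (frame A B) (suc (c + i) , d + suc s) ≡ at (rowOf B (suc i)) s
      entry-β {i} i< = entry≡ {frame A B} (begin
        rowOf (frame A B) (suc (c + i))
          ≡⟨ cong (λ k → rowOf (frame A B) (suc (k + i))) (sym (trans (sym (+-assoc a (length α) g)) (m+[n∸m]≡n rows))) ⟩
        rowOf (frame A B) (suc ((a + (length α + g)) + i))
          ≡⟨ cong (rowOf (frame A B) ∘ suc) (trans (+-assoc a _ i) (cong (a +_) (trans (+-assoc (length α) g i) (cong (_+ (g + i)) lenA)))) ⟩
        rowOf (frame A B) (suc (a + (length A + (g + i))))
          ≡⟨ rowOf-replicate-++ a _ ⟩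
        rowOf (A ++ (replicate g [] ++ (B ++ replicate e []))) (suc (length A + (g + i)))
          ≡⟨ rowOf-++ʳ A _ ⟩
        rowOf (replicate g [] ++ (B ++ replicate e [])) (suc (g + i))
          ≡⟨ rowOf-replicate-++ g i ⟩
        rowOf (B ++ replicate e []) (suc i)
          ≡⟨ rowOf-++ˡ B (subst (i <_) lenB i<) ⟩
        rowOf B (suc i) ∎) (β-μ i<)
        where open ≡-Reasoning

      in-α : ∀ i {s} → s < at α i → (suc (a + i) , b + suc s) ∈ skewBoxes la mu
      in-α i s< = subst (_ ∈_) (sym (skewBoxes-layout Λ)) (∈-++⁺ˡ (∈-boxes⁺ α i s<))

      in-β : ∀ i {s} → s < at β i → (suc (c + i) , d + suc s) ∈ skewBoxes la mu
      in-β i s< = subst (_ ∈_) (sym (skewBoxes-layout Λ)) (∈-++⁺ʳ (boxes a b α) (∈-boxes⁺ β i s<))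

      row<α : ∀ {i s} → s < at α i → i < length α
      row<α s< = at-positive⁻ α (≤-trans (s≤s z≤n) s<)

      row<β : ∀ {i s} → s < at β i → i < length β
      row<β s< = at-positive⁻ β (≤-trans (s≤s z≤n) s<)

      columns-apart : ∀ {i s s′} → s′ < at β i → ¬ (b + suc s ≡ d + suc s′)
      columns-apart {i} {s} {s′} s′< eq = <-irrefl (sym eq)
        (≤-<-trans (≤-trans (+-monoʳ-≤ d (≤-trans s′< (at-antitone Pβ z≤n))) cols) (m<m+n b (s≤s z≤n)))

    columnStrict⇒ : ColumnStrict (frame A B) → Cols α A × Cols β B
    columnStrict⇒ cs =
      (λ i {s} s< → subst₂ _<_ (entry-α (row<α (<-≤-trans s< (at-decreasing Pα i))))
        (trans (cong (λ k → entry mu (frame A B) (suc k , b + suc s)) (sym (+-suc a i))) (entry-α (row<α s<)))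
        (cs (in-α i (<-≤-trans s< (at-decreasing Pα i)))
            (subst (λ k → (suc k , b + suc s) ∈ skewBoxes la mu) (+-suc a i) (in-α (suc i) s<)))) ,
      (λ i {s} s< → subst₂ _<_ (entry-β (row<β (<-≤-trans s< (at-decreasing Pβ i))))
        (trans (cong (λ k → entry mu (frame A B) (suc k , d + suc s)) (sym (+-suc c i))) (entry-β (row<β s<)))
        (cs (in-β i (<-≤-trans s< (at-decreasing Pβ i)))
            (subst (λ k → (suc k , d + suc s) ∈ skewBoxes la mu) (+-suc c i) (in-β (suc i) s<))))

    -- A box and the one below it share a column and hence a piece, so no column condition links α
    -- with β.
    columnStrict⇐ : Cols α A → Cols β B → ColumnStrict (frame A B)
    columnStrict⇐ hA hB x∈ y∈
      with ∈-++⁻ (boxes a b α) (subst (_ ∈_) (skewBoxes-layout Λ) x∈) | ∈-++⁻ (boxes a b α) (subst (_ ∈_) (skewBoxes-layout Λ) y∈)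
    ... | inj₁ x∈α | inj₁ y∈α with i , s , refl , s< ← ∈-boxes⁻ α x∈α with i′ , s′ , eq , s′< ← ∈-boxes⁻ α y∈α =
      below i′ s′ (+-cancelˡ-≡ a _ _ (trans (+-suc a i) (suc-injective (cong proj₁ eq))))
        (suc-injective (+-cancelˡ-≡ b _ _ (cong proj₂ eq))) s′<
      where
      below : ∀ i′ s′ → suc i ≡ i′ → s ≡ s′ → s′ < at α i′ → _
      below _ _ refl refl s′< = subst₂ _<_ (sym (entry-α (row<α s<)))
        (sym (trans (cong (λ k → entry mu (frame A B) (suc k , b + suc s)) (sym (+-suc a i))) (entry-α (row<α s′<)))) (hA i s′<)
    ... | inj₂ x∈β | inj₂ y∈β with i , s , refl , s< ← ∈-boxes⁻ β x∈β with i′ , s′ , eq , s′< ← ∈-boxes⁻ β y∈β =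
      below i′ s′ (+-cancelˡ-≡ c _ _ (trans (+-suc c i) (suc-injective (cong proj₁ eq))))
        (suc-injective (+-cancelˡ-≡ d _ _ (cong proj₂ eq))) s′<
      where
      below : ∀ i′ s′ → suc i ≡ i′ → s ≡ s′ → s′ < at β i′ → _
      below _ _ refl refl s′< = subst₂ _<_ (sym (entry-β (row<β s<)))
        (sym (trans (cong (λ k → entry mu (frame A B) (suc k , d + suc s)) (sym (+-suc c i))) (entry-β (row<β s′<)))) (hB i s′<)
    ... | inj₁ x∈α | inj₂ y∈β with i , s , refl , s< ← ∈-boxes⁻ α x∈α with i′ , s′ , eq , s′< ← ∈-boxes⁻ β y∈β =
      contradiction (cong proj₂ eq) (columns-apart s′<)
    ... | inj₂ x∈β | inj₁ y∈α with i , s , refl , s< ← ∈-boxes⁻ β x∈β with i′ , s′ , eq , s′< ← ∈-boxes⁻ α y∈α =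
      contradiction (sym (cong proj₂ eq)) (columns-apart s<)

  module _ {ν} (Pν : IsPartition ν) where

    isLR⇒ : ∀ {t} → t ∈ fillings la mu (length ν) → T (isLR la mu ν t) →
            ∃ λ B → LR α β ν B × t ≡ frame (super 0 α) B
    isLR⇒ {t} t∈ h
      with A , B , refl , FA , FB ← fillings⁻ t∈
      with ssyt , h′ ← to (T-∧ {isSSYT la mu t}) h
      with content , lattice ← to (T-∧ {hasContent ν t}) h′
      with so , cs ← isSSYT⇒ t ssyt
      with colsA , colsB ← columnStrict⇒ {A} {B} (Pointwise-length FA) (Pointwise-length FB) cs
      = from-chain (lattice⇒chain t so (isLattice⇒ bounded lattice) (hasContent⇒ {ν} {t} letters content))
      where
      letters : ∀ {v x} → v ∈ t → x ∈ v → x ≤ length ν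
      letters v∈ x∈ = proj₂ (pointwise-row (choices⁻ (length ν) (arrange Λ 0 α β) (subst (t ∈_) (fillings≡ (length ν)) t∈)) v∈ x∈)
        where
        pointwise-row : ∀ {m rs u} → Pointwise (RowFilling m) rs u → ∀ {v} → v ∈ u → ∀ {x} → x ∈ v → 1 ≤ x × x ≤ m
        pointwise-row ((_ , b) ∷ F) (here refl) = b
        pointwise-row (_ ∷ F)       (there v∈)  = pointwise-row F v∈

      bounded : ∀ {x} → x ∈ reading t → x ≤ length ν
      bounded x∈ with v , v∈ , x∈v ← ∈-reading⁻ t x∈ = letters v∈ x∈v

      from-chain : Chain (at ν) (λ _ → 0) t → ∃ λ B → LR α β ν B × t ≡ frame (super 0 α) B
      from-chain ch
        with r₁ , ch₁ , ch′ ← chain-++⁻ (replicate a []) ch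
        with r₂ , ch₂ , ch″ ← chain-++⁻ A ch′
        with r₃ , ch₃ , ch‴ ← chain-++⁻ (replicate g []) ch″
        with r₄ , ch₄ , ch₅ ← chain-++⁻ B ch‴
        -- The upper piece is read from content zero, so only the superstandard filling is possible,
        -- and the content `r₂` after it is that of α.
        with A≡ , _ , r₂≡ ← tab-super 0 Pα (λ _ → z≤n) (λ _ → refl)
               (tab-intro {f = λ _ → 0} FA (All.++⁻ˡ A (All.++⁻ʳ (replicate a []) so))
                 (chain-cong (sym ∘ chain-empty⁻ a ch₁) ch₂) (filling-positive FA) colsA)
        = B , tab-cong (λ k → trans (sym (chain-empty⁻ g ch₃ k)) (r₂≡ k)) (chain-empty⁻ e ch₅)
                (tab-intro FB (All.++⁻ˡ B (All.++⁻ʳ (replicate g []) (All.++⁻ʳ A (All.++⁻ʳ (replicate a []) so))))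
                  ch₄ (filling-positive FB) colsB) ,
          cong (λ A → frame A B) A≡

    isLR⇐ : ∀ {B} → LR α β ν B →
            frame (super 0 α) B ∈ fillings la mu (length ν) × T (isLR la mu ν (frame (super 0 α) B))
    isLR⇐ {B} tB = fillings⁺ FA FB ,
      from (T-∧ {isSSYT la mu t}) (isSSYT⇐ t sorted strict ,
        from (T-∧ {hasContent ν t}) (hasContent⇐ {ν} {t} (chain-content ch) , isLattice⇐ {length ν} (chain⇒lattice (at-decreasing Pν) ch)))
      where
      A = super 0 α
      t = frame A B

      tA : LR [] α α A
      tA = LR-super Pα

      ch : Chain (at ν) (λ _ → 0) t
      ch = chain-++⁺ (chain-empty⁺ a (λ _ → z≤n) (λ _ → refl)) (chain-++⁺ (tab-chain tA)
        (chain-++⁺ (chain-empty⁺ g (at-decreasing Pα) (λ _ → refl)) (chain-++⁺ (tab-chain tB)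
          (chain-empty⁺ e (at-decreasing Pν) (λ _ → refl)))))

      -- `fillings` only offers letters up to l(ν). A letter that occurs has positive multiplicity
      -- in ν and is thus in this range.
      letters : ∀ {v x} → v ∈ t → x ∈ v → x ≤ length ν
      letters {x = zero}  _  _  = z≤n
      letters {x = suc x} v∈ x∈ = at-positive⁻ ν (chain-letter ch v∈ x∈)

      FA : Pointwise (RowFilling (length ν)) α A
      FA = tab-filling (λ v∈ → letters (∈-++⁺ʳ (replicate a []) (∈-++⁺ˡ v∈))) tA

      FB : Pointwise (RowFilling (length ν)) β B
      FB = tab-filling (λ v∈ → letters (∈-++⁺ʳ (replicate a []) (∈-++⁺ʳ A (∈-++⁺ʳ (replicate g []) (∈-++⁺ˡ v∈))))) tB

      sorted : All Sorted t
      sorted = All.++⁺ (All.replicate⁺ a []) (All.++⁺ (tab-sorted tA)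
        (All.++⁺ (All.replicate⁺ g []) (All.++⁺ (tab-sorted tB) (All.replicate⁺ e []))))

      strict : ColumnStrict t
      strict = columnStrict⇐ {A} {B} (Pointwise-length FA) (Pointwise-length FB) (tab-cols tA) (tab-cols tB)

    lrCoeff≢0⇒ : lrCoeff la mu ν ≢ 0 → ∃ (LR α β ν)
    lrCoeff≢0⇒ h with t , t∈ , lr ← length-filter-zero (isLR la mu ν) (fillings la mu (length ν)) h
      with B , tB , _ ← isLR⇒ t∈ lr = B , tB

    lrCoeff≡1 : ∀ {B} → LR α β ν B → (∀ {B′} → LR α β ν B′ → B′ ≡ B) → lrCoeff la mu ν ≡ 1
    lrCoeff≡1 {B} tB unique = length-filter-one (isLR la mu ν) (fillings-unique (length ν)) (proj₁ (isLR⇐ tB)) (proj₂ (isLR⇐ tB))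
      λ t∈ lr → let B′ , tB′ , t≡ = isLR⇒ t∈ lr in trans t≡ (cong (frame (super 0 α)) (unique tB′))

  extremal-constituents :
    IsHlOf la mu (hl α ⊕ hl β)
    × (hl α ⊕ hl β ≡ πnw la mu)
    × (Σ (List (List ℕ)) λ L →
         All IsPartition L × Unique L
         × (length L ≡ 2 ^ (durfee α ⊓ durfee β))
         × (∀ nu → IsPartition nu → (nu ∈ L ⇔ (Appears la mu nu × (hl nu ≡ hl α ⊕ hl β))))
         × (∀ nu → nu ∈ L → lrCoeff la mu nu ≡ 1))
  extremal-constituents =
    (witness L refl , λ ν (Pν , h) → hl-bound n ≤-refl Pα Pβ Pν (proj₂ (lrCoeff≢0⇒ Pν h))) ,
    πnw-layout Λ Pα Pβ ,
    L , All.tabulate (Top.partition ∘ sound) , tops-unique n Pα Pβ , length-tops n ≤-refl Pα Pβ ,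
    (λ ν Pν → mk⇔ (λ ν∈ → appears ν∈ , Top.hooks (sound ν∈))
                  (λ ((_ , h) , eq) → tops-complete n ≤-refl Pα Pβ Pν eq (proj₂ (lrCoeff≢0⇒ Pν h)))) ,
    λ ν → multiplicity
    where
    n = length α
    L = tops n α β

    sound : ∀ {ν} → ν ∈ L → Top α β ν
    sound = tops-sound n Pα Pβ

    multiplicity : ∀ {ν} → ν ∈ L → lrCoeff la mu ν ≡ 1
    multiplicity ν∈ with top ← sound ν∈ with B , tB ← Top.filling top =
      lrCoeff≡1 (Top.partition top) tB λ tB′ → tableau-unique n ≤-refl Pα Pβ (Top.partition top) (Top.hooks top) tB′ tB

    appears : ∀ {ν} → ν ∈ L → Appears la mu ν
    appears ν∈ = Top.partition (sound ν∈) , λ h → contradiction (trans (sym h) (multiplicity ν∈)) λ ()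

    -- The list cannot be empty, since its length is a power of two.
    witness : ∀ K → K ≡ L → Σ (List ℕ) λ ν → Appears la mu ν × hl ν ≡ hl α ⊕ hl β
    witness [] e = contradiction (trans (cong length e) (length-tops n ≤-refl Pα Pβ)) (<⇒≢ (m^n>0 2 (durfee α ⊓ durfee β)))
    witness (ν ∷ _) e = ν , appears ν∈ , Top.hooks (sound ν∈)
      where
      ν∈ : ν ∈ L
      ν∈ = subst (ν ∈_) e (here refl)

-- Exchanging the two pieces

⊕-comm : ∀ xs ys → xs ⊕ ys ≡ ys ⊕ xs
⊕-comm []       []       = refl
⊕-comm []       (_ ∷ _)  = refl
⊕-comm (_ ∷ _)  []       = refl
⊕-comm (x ∷ xs) (y ∷ ys) = cong₂ _∷_ (+-comm x y) (⊕-comm xs ys)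

theorem3p1 : (la mu al be : List ℕ) → IsPartition la → IsPartition mu → mu ⊆P la
    → IsPartition al → IsPartition be → ¬ (al ≡ []) → ¬ (be ≡ [])
    → DecomposesInto la mu al be
    → IsHlOf la mu (hl al ⊕ hl be)
    × (hl al ⊕ hl be ≡ πnw la mu)
    × (Σ (List (List ℕ)) λ L →
    All IsPartition L × Unique L
    × (length L ≡ 2 ^ (durfee al ⊓ durfee be))
    × (∀ nu → IsPartition nu → (nu ∈ L ⇔ (Appears la mu nu × (hl nu ≡ hl al ⊕ hl be))))
    × (∀ nu → nu ∈ L → lrCoeff la mu nu ≡ 1))
theorem3p1 la mu al be _ Pμ _ Pα Pβ α≢[] β≢[] D with decompose {la} Pμ Pα Pβ α≢[] β≢[] D
... | inj₁ Λ = extremal-constituents Λ Pα Pβ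
-- If β is the upper piece the roles are exchanged; the two rewrites make the goal symmetric to the
-- first case.
... | inj₂ Λ rewrite ⊕-comm (hl al) (hl be) | ⊓-comm (durfee al) (durfee be) = extremal-constituents Λ Pβ Pα
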